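{- Let $\mu=\max_{a>0}\dfrac{2+2a-a^2}{\sqrt{2}\sqrt{1+a}}=\left(\tfrac{2}{3}\right)^{3/2}\dfrac{1+2\sqrt{7}}{\sqrt{2+\sqrt{7}}}\approx1.58887$. There exists a function $g$ with $g(r)/r\to0$ as $r\to\infty$ such that for every positive integer $r$ there exists a $\overline{\mathrm{DD}}^*(m,r)$ with $m\ge(\mu/2)r-g(r)$ (so $m\approx0.79444\,r$).
   Context: Represent the hexagonal grid by $\mathbb{Z}^2$, where $(i,j)$ has neighbours $(i\pm1,j)$, $(i,j\pm1)$, $(i+1,j+1)$, $(i-1,j-1)$ (the adjacency graph of a regular hexagonal tiling, identifying $(i,j)$ with the plane point $i(1,0)+j(-\tfrac12,\tfrac{\sqrt3}{2})$). The hexagonal distance is the graph distance in this graph. A $\overline{\mathrm{DD}}^*(m,r)$ is a set of $m$ grid points ("dots") such that any two dots are at hexagonal distance at most $r$, and the vectors $a-b$, over ordered pairs $(a,b)$ of distinct dots, are pairwise distinct (i.e. the lines joining pairs of dots differ in length or slope). -}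

module Defs where

open import Data.Nat using (ℕ; zero; suc)
open import Data.Integer as ℤ using (ℤ; +_)
open import Data.Product using (_×_; _,_; Σ; ∃)
open import Data.Fin using (Fin)
open import Relation.Binary.PropositionalEquality using (_≡_)
open import Relation.Nullary using (¬_)
open import Data.Rational as ℚ using (ℚ; _/_)

-- Grid points of the hexagonal grid, represented by ℤ².
Point : Set
Point = ℤ × ℤ

_-ᵖ_ : Point → Point → Point
(a , b) -ᵖ (c , d) = (a ℤ.- c) , (b ℤ.- d)

data Adj : Point → Point → Set where
  e+ : ∀ i j → Adj (i , j) (i ℤ.+ + 1 , j)
  e- : ∀ i j → Adj (i , j) (i ℤ.- + 1 , j)
  n+ : ∀ i j → Adj (i , j) (i , j ℤ.+ + 1)
  n- : ∀ i j → Adj (i , j) (i , j ℤ.- + 1)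
  d+ : ∀ i j → Adj (i , j) (i ℤ.+ + 1 , j ℤ.+ + 1)
  d- : ∀ i j → Adj (i , j) (i ℤ.- + 1 , j ℤ.- + 1)

data Walk : ℕ → Point → Point → Set where
  here : ∀ p → Walk zero p p
  step : ∀ {k p q s} → Adj p q → Walk k q s → Walk (suc k) p s

HexDist≤ : Point → Point → ℕ → Set
HexDist≤ p q r = Σ ℕ λ k → (k Data.Nat.≤ r) × Walk k p q
  where import Data.Nat

record IsDDStar (m r : ℕ) (dot : Fin m → Point) : Set where
  field
    distinct : ∀ i j → dot i ≡ dot j → i ≡ j
    close    : ∀ i j → HexDist≤ (dot i) (dot j) r
    diffs    : ∀ i j k l → ¬ (i ≡ j) → ¬ (k ≡ l) →
               (dot i -ᵖ dot j) ≡ (dot k -ᵖ dot l) → (i ≡ k) × (j ≡ l)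

DDStar : ℕ → ℕ → Set
DDStar m r = Σ (Fin m → Point) (IsDDStar m r)

ℕ→ℚ : ℕ → ℚ
ℕ→ℚ n = + n / 1

-- c < μ/2, expressed algebraically: μ = sup_{a>0} (2+2a-a²)/(√2 √(1+a)),
-- and by continuity the sup may be taken over rational a > 0. For c ≥ 0,
-- c < (2+2a-a²)/(2√2√(1+a)) iff 2+2a-a² > 0 and 8c²(1+a) < (2+2a-a²)².
BelowHalfMu : ℚ → Set
BelowHalfMu c = Σ ℚ λ a →
    (ℚ.0ℚ ℚ.< a)
  × (ℚ.0ℚ ℚ.< P a)
  × (ℚ.0ℚ ℚ.≤ c)
  × ((ℕ→ℚ 8 ℚ.* (c ℚ.* c)) ℚ.* (ℚ.1ℚ ℚ.+ a) ℚ.< P a ℚ.* P a)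
  where
  P : ℚ → ℚ
  P a = (ℕ→ℚ 2 ℚ.+ ℕ→ℚ 2 ℚ.* a) ℚ.- a ℚ.* a

{-# OPTIONS --safe #-}

-- Let p be an odd prime. Among points with pairwise incongruent coordinates mod p, those with x² + y ≡ t have distinct
-- differences: a difference (Δx , Δy) with Δx ≢ 0 determines the sum of the abscissae mod p, since Δy ≡ - Δx (x + x′).
-- Hence a set of N points that is injective mod p and lies in a hexagon of diameter r contains, for some t, a DD set of
-- at least N / p points. Reducing the hexagon mod p covers at least p² - (2p - 3r/2)² residues, which gives
-- m ≥ (1589/2000) r > (μ/2) r as soon as 0.816 r ≤ p ≤ (45/49) r.
--
-- It remains to find a prime between n and 9n/8 for large n, by Chebyshev's method: a product of factorials (N/b)!,
-- with exponents c of either sign and Σ c/b = 0, has exponential growth, while the exponent of a prime p > √N in it is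
-- f (N/p), where f (t) = Σ c ⌊t/b⌋. The combination used below, found by linear programming, has f (t) ≤ 0 unless
-- 8 ≤ t < 9 or t ≥ 2016, so primes in (N/9, N/8] are needed to account for the growth.

module Submission where

-- With s = p / r, the guaranteed count divided by r is about 6 - 3s - 9/(4s). Its maximum 6 - 3√3 ≈
-- 0.8038, at s = √3/2, exceeds μ/2 ≈ 0.7944. This surplus shapes the proof: p need not be
-- asymptotic to a prescribed multiple of r, since every s between 0.816 and 45/49 already gives
-- 1589/2000 > μ/2. For large r no error term remains, and μ itself enters only through the rational
-- bound 1589/2000. The quotient of the two ends of the window is just above 9/8, which dictates the
-- prime gap that has to be proved. Folding is possible because the parabola argument sees
-- coordinates only mod p: dots may be moved by multiples of p until they lie in the hexagon. In the
-- Chebyshev estimate the tail t ≥ 2016 is paid for by exp ψ(N/2016) ≤ 16^(N/2016). With N = 5040 x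
-- its square costs at most 20 x bits, while the factorials grow by at least 25 x bits; all other
-- errors cost O(√x log x) bits.

-- Prime factorisations as products over ranges, and Legendre's formula

module PrimeProducts where

  open import Data.Nat
  open import Data.Nat.Properties
  open import Data.Nat.DivMod
  open import Data.Nat.Divisibility
  open import Data.Nat.Primality
  open import Data.Nat.Primality.Factorisation using (PrimeFactorisation; factorise)
  open import Data.Nat.ListAction using (product)
  open import Data.Nat.Tactic.RingSolver using (solve-∀)
  open import Data.List using (List; []; _∷_)
  open import Data.List.Relation.Unary.All using (All; []; _∷_)
  open import Data.Product using (_×_; _,_)
  open import Data.Sum using (_⊎_; inj₁; inj₂)
  open import Function using (_∘_; case_of_)
  open import Relation.Binary.PropositionalEquality
  open import Relation.Nullary using (¬_; yes; no; contradiction)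

  ∏ : ℕ → (ℕ → ℕ) → ℕ
  ∏ zero    f = 1
  ∏ (suc n) f = ∏ n f * f n

  ∏-cong : ∀ n {f g : ℕ → ℕ} → (∀ i → i < n → f i ≡ g i) → ∏ n f ≡ ∏ n g
  ∏-cong zero    h = refl
  ∏-cong (suc n) h = cong₂ _*_ (∏-cong n λ i i<n → h i (m<n⇒m<1+n i<n)) (h n ≤-refl)

  ∏-mono : ∀ n {f g : ℕ → ℕ} → (∀ i → i < n → f i ≤ g i) → ∏ n f ≤ ∏ n g
  ∏-mono zero    h = ≤-refl
  ∏-mono (suc n) h = *-mono-≤ (∏-mono n λ i i<n → h i (m<n⇒m<1+n i<n)) (h n ≤-refl)

  ∏-distrib-* : ∀ n (f g : ℕ → ℕ) → ∏ n (λ i → f i * g i) ≡ ∏ n f * ∏ n g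
  ∏-distrib-* zero    f g = refl
  ∏-distrib-* (suc n) f g = begin
    ∏ n (λ i → f i * g i) * (f n * g n) ≡⟨ cong (_* (f n * g n)) (∏-distrib-* n f g) ⟩
    ∏ n f * ∏ n g * (f n * g n)         ≡⟨ [m*n]*[o*p]≡[m*o]*[n*p] (∏ n f) (∏ n g) (f n) (g n) ⟩
    ∏ n f * f n * (∏ n g * g n)         ∎
    where open ≡-Reasoning

  ∏-const : ∀ n c → ∏ n (λ _ → c) ≡ c ^ n
  ∏-const zero    c = refl
  ∏-const (suc n) c = trans (cong (_* c) (∏-const n c)) (*-comm (c ^ n) c)

  ∏-one : ∀ n {f : ℕ → ℕ} → (∀ i → i < n → f i ≡ 1) → ∏ n f ≡ 1
  ∏-one n h = trans (∏-cong n h) (trans (∏-const n 1) (^-zeroˡ n))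

  ∏-head : ∀ n (f : ℕ → ℕ) → ∏ (suc n) f ≡ f 0 * ∏ n (f ∘ suc)
  ∏-head zero    f = *-comm 1 (f 0)
  ∏-head (suc n) f = begin
    ∏ (suc n) f * f (suc n)             ≡⟨ cong (_* f (suc n)) (∏-head n f) ⟩
    f 0 * ∏ n (f ∘ suc) * f (suc n)     ≡⟨ *-assoc (f 0) _ _ ⟩
    f 0 * (∏ n (f ∘ suc) * f (suc n))   ∎
    where open ≡-Reasoning

  ∏-single : ∀ n q (f : ℕ → ℕ) → q < n → (∀ i → i < n → ¬ i ≡ q → f i ≡ 1) → ∏ n f ≡ f q
  ∏-single (suc n) q f q<1+n h with n ≟ q
  ... | yes refl = trans (cong (_* f n) (∏-one n λ i i<n → h i (m<n⇒m<1+n i<n) (<⇒≢ i<n))) (*-identityˡ (f n))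
  ... | no n≢q = begin
    ∏ n f * f n ≡⟨ cong (∏ n f *_) (h n ≤-refl n≢q) ⟩
    ∏ n f * 1   ≡⟨ *-identityʳ _ ⟩
    ∏ n f       ≡⟨ ∏-single n q f (≤∧≢⇒< (s≤s⁻¹ q<1+n) (n≢q ∘ sym)) (λ i i<n → h i (m<n⇒m<1+n i<n)) ⟩
    f q         ∎
    where open ≡-Reasoning

  -- Division made total by n ÷ 0 = 0, so that no NonZero instance is needed for d = p ^ k.
  infixl 7 _÷_
  _÷_ : ℕ → ℕ → ℕ
  n ÷ zero  = 0
  n ÷ suc d = n / suc d

  ÷-mono : ∀ d {m n} → m ≤ n → m ÷ d ≤ n ÷ d
  ÷-mono zero    m≤n = z≤n
  ÷-mono (suc d) m≤n = /-monoˡ-≤ (suc d) m≤n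

  ÷-÷ : ∀ n d e → n ÷ d ÷ e ≡ n ÷ (d * e)
  ÷-÷ n zero zero       = refl
  ÷-÷ n zero (suc e)    = 0/n≡0 (suc e)
  ÷-÷ n (suc d) zero    = cong (n ÷_) (sym (*-zeroʳ d))
  ÷-÷ n (suc d) (suc e) = m/n/o≡m/[n*o] n (suc d) (suc e)

  ÷-comm : ∀ n d e → n ÷ d ÷ e ≡ n ÷ e ÷ d
  ÷-comm n d e = trans (÷-÷ n d e) (trans (cong (n ÷_) (*-comm d e)) (sym (÷-÷ n e d)))

  m*n÷n≡m : ∀ m n .{{_ : NonZero n}} → (m * n) ÷ n ≡ m
  m*n÷n≡m m (suc n) = m*n/n≡m m (suc n)

  +-*-÷ : ∀ m k n .{{_ : NonZero n}} → (m + k * n) ÷ n ≡ m ÷ n + k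
  +-*-÷ m k (suc n) = trans (+-distrib-/-∣ʳ m (n∣m*n k)) (cong (m / suc n +_) (m*n/n≡m k (suc n)))

  ÷-small : ∀ {n d} → n < d → n ÷ d ≡ 0
  ÷-small {d = suc d} n<d = m<n⇒m/n≡0 n<d

  ⟦_∣_⟧ : ℕ → ℕ → ℕ
  ⟦ d ∣ n ⟧ with d ∣? n
  ... | yes _ = 1
  ... | no  _ = 0

  ⟦∣⟧-yes : ∀ {d n} → d ∣ n → ⟦ d ∣ n ⟧ ≡ 1
  ⟦∣⟧-yes {d} {n} d∣n with d ∣? n
  ... | yes _   = refl
  ... | no  d∤n = contradiction d∣n d∤n

  ⟦∣⟧-no : ∀ {d n} → ¬ d ∣ n → ⟦ d ∣ n ⟧ ≡ 0
  ⟦∣⟧-no {d} {n} d∤n with d ∣? n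
  ... | yes d∣n = contradiction d∣n d∤n
  ... | no  _   = refl

  ⟦∣⟧-cong : ∀ {d n e m} → (d ∣ n → e ∣ m) → (e ∣ m → d ∣ n) → ⟦ d ∣ n ⟧ ≡ ⟦ e ∣ m ⟧
  ⟦∣⟧-cong {d} {n} to from with d ∣? n
  ... | yes d∣n = sym (⟦∣⟧-yes (to d∣n))
  ... | no  d∤n = sym (⟦∣⟧-no (d∤n ∘ from))

  suc-÷ : ∀ n d → suc n ÷ d ≡ ⟦ d ∣ suc n ⟧ + n ÷ d
  suc-÷ n zero = sym (trans (+-identityʳ _) (⟦∣⟧-no {0} {suc n} λ 0∣ → case 0∣⇒≡0 0∣ of λ ()))
  suc-÷ n d@(suc d-1) with d ∣? suc n
  ... | yes (divides (suc q) eq) = begin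
    suc n / d                ≡⟨ /-congˡ {o = d} eq ⟩
    suc q * d / d            ≡⟨ m*n/n≡m (suc q) d ⟩
    suc q                    ≡⟨ cong suc (m*n/n≡m q d) ⟨
    suc (q * d / d)          ≡⟨ cong suc (cong (_+ q * d / d) (m<n⇒m/n≡0 (n<1+n d-1))) ⟨
    suc (d-1 / d + q * d / d) ≡⟨ cong suc (+-distrib-/-∣ʳ d-1 {q * d} {d} (n∣m*n q)) ⟨
    suc ((d-1 + q * d) / d)  ≡⟨ cong suc (/-congˡ {o = d} (suc-injective eq)) ⟨
    suc (n / d)              ∎
    where open ≡-Reasoning
  ... | no d∤ = begin
    suc n / d                            ≡⟨ /-congˡ {o = d} (cong suc (m≡m%n+[m/n]*n n d)) ⟩
    (suc (n % d) + n / d * d) / d        ≡⟨ +-distrib-/-∣ʳ (suc (n % d)) (n∣m*n (n / d)) ⟩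
    suc (n % d) / d + n / d * d / d      ≡⟨ cong₂ _+_ (m<n⇒m/n≡0 r<d) (m*n/n≡m (n / d) d) ⟩
    n / d                                ∎
    where
    open ≡-Reasoning
    r<d : suc (n % d) < d
    r<d = ≤∧≢⇒< (m%n<n n d) λ eq → d∤ (divides (suc (n / d))
      (trans (cong suc (m≡m%n+[m/n]*n n d)) (cong (_+ n / d * d) eq)))

  -- ω p is p for a prime p and 1 otherwise, so that products over primes become products over ranges.
  ω : ℕ → ℕ
  ω p with prime? p
  ... | yes _ = p
  ... | no  _ = 1

  ω-prime : ∀ {p} → Prime p → ω p ≡ p
  ω-prime {p} pr with prime? p
  ... | yes _  = refl
  ... | no ¬pr = contradiction pr ¬pr

  ω-cases : ∀ p → (Prime p × ω p ≡ p) ⊎ (¬ Prime p × ω p ≡ 1)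
  ω-cases p with prime? p
  ... | yes pr = inj₁ (pr , refl)
  ... | no ¬pr = inj₂ (¬pr , refl)

  ω-nonZero : ∀ p → NonZero (ω p)
  ω-nonZero p with prime? p
  ... | yes pr = prime⇒nonZero pr
  ... | no _   = _

  -- The number in which each prime p has the exponent Σ e (p ^ k) over k ≥ 1, cut off at `B` in
  -- both indices. A pointwise inequality between exponent functions thus becomes an inequality
  -- between numbers, without logarithms.
  Π : ℕ → (ℕ → ℕ) → ℕ
  Π B e = ∏ B λ p → ∏ B λ k → ω p ^ e (p ^ suc k)

  Π-cong : ∀ B {e e′ : ℕ → ℕ} → (∀ d → e d ≡ e′ d) → Π B e ≡ Π B e′
  Π-cong B h = ∏-cong B λ p _ → ∏-cong B λ k _ → cong (ω p ^_) (h (p ^ suc k))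

  Π-mono : ∀ B {e e′ : ℕ → ℕ} → (∀ d → e d ≤ e′ d) → Π B e ≤ Π B e′
  Π-mono B h = ∏-mono B λ p _ → ∏-mono B λ k _ → ^-monoʳ-≤ (ω p) {{ω-nonZero p}} (h (p ^ suc k))

  Π-+ : ∀ B (e e′ : ℕ → ℕ) → Π B (λ d → e d + e′ d) ≡ Π B e * Π B e′
  Π-+ B e e′ = trans
    (∏-cong B λ p _ → trans
      (∏-cong B λ k _ → ^-distribˡ-+-* (ω p) (e (p ^ suc k)) (e′ (p ^ suc k)))
      (∏-distrib-* B _ _))
    (∏-distrib-* B _ _)

  Π-0 : ∀ B → Π B (λ _ → 0) ≡ 1
  Π-0 B = ∏-one B λ p _ → ∏-one B λ k _ → refl

  Π-*ˡ : ∀ B c (e : ℕ → ℕ) → Π B (λ d → c * e d) ≡ Π B e ^ c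
  Π-*ˡ B zero    e = Π-0 B
  Π-*ˡ B (suc c) e = trans (Π-+ B e (λ d → c * e d)) (cong (Π B e *_) (Π-*ˡ B c e))

  prime∣^⇒≡ : ∀ {p q} → Prime p → Prime q → ∀ k → q ∣ p ^ k → q ≡ p
  prime∣^⇒≡ pp pq zero q∣1 = contradiction (subst Prime (∣1⇒≡1 q∣1) pq) ¬prime[1]
  prime∣^⇒≡ {p} pp pq (suc k) q∣ with euclidsLemma p (p ^ k) pq q∣
  ... | inj₂ q∣pᵏ = prime∣^⇒≡ pp pq k q∣pᵏ
  ... | inj₁ q∣p with prime⇒irreducible pp q∣p
  ...   | inj₁ refl = contradiction pq ¬prime[1]
  ...   | inj₂ q≡p  = q≡p

  prime-power-∣-cancel : ∀ {p q} → Prime p → Prime q → ¬ p ≡ q → ∀ k n → p ^ k ∣ q * n → p ^ k ∣ n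
  prime-power-∣-cancel pp pq p≢q zero n _ = 1∣ n
  prime-power-∣-cancel {p} {q} pp pq p≢q (suc k) n pᵏ⁺¹∣ with euclidsLemma q n pp (∣-trans (m∣m*n (p ^ k)) pᵏ⁺¹∣)
  ... | inj₁ p∣q = contradiction (prime∣^⇒≡ pq pp 1 (∣-trans p∣q (∣-reflexive (sym (*-identityʳ q))))) p≢q
  ... | inj₂ (divides n′ refl) = ∣-trans (*-monoʳ-∣ p (prime-power-∣-cancel pp pq p≢q k n′
          (*-cancelˡ-∣ p {{prime⇒nonZero pp}} (∣-trans pᵏ⁺¹∣ (∣-reflexive (move q n′ p))))))
        (∣-reflexive (*-comm p n′))
    where
    move : ∀ a b c → a * (b * c) ≡ c * (a * b)
    move = solve-∀

  n<2^n : ∀ n → n < 2 ^ n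
  n<2^n zero    = s≤s z≤n
  n<2^n (suc n) = begin-strict
    suc n         ≡⟨ +-comm 1 n ⟩
    n + 1         <⟨ +-mono-<-≤ (n<2^n n) (m^n>0 2 n) ⟩
    2 ^ n + 2 ^ n ≡⟨ cong (2 ^ n +_) (+-identityʳ (2 ^ n)) ⟨
    2 ^ suc n     ∎
    where open ≤-Reasoning

  n<p^n : ∀ {p} → Prime p → ∀ n → n < p ^ n
  n<p^n pp n = <-≤-trans (n<2^n n) (^-monoˡ-≤ n (nonTrivial⇒n>1 _ {{prime⇒nonTrivial pp}}))

  part : ℕ → ℕ → ℕ → ℕ
  part B p n = ∏ B λ k → ω p ^ ⟦ p ^ suc k ∣ n ⟧

  part-≢ : ∀ B {p q} n → Prime q → ¬ p ≡ q → part B p (q * n) ≡ part B p n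
  part-≢ B {p} {q} n pq p≢q with ω-cases p
  ... | inj₁ (pp , _) = ∏-cong B λ k _ → cong (ω p ^_)
    (⟦∣⟧-cong (prime-power-∣-cancel pp pq p≢q (suc k) n) (∣n⇒∣m*n q))
  ... | inj₂ (_ , ω≡1) = trans (unit (q * n)) (sym (unit n))
    where
    unit : ∀ m → part B p m ≡ 1
    unit m = ∏-one B λ k _ → trans (cong (_^ ⟦ p ^ suc k ∣ m ⟧) ω≡1) (^-zeroˡ ⟦ p ^ suc k ∣ m ⟧)

  -- q ^ (k + 1) divides q * n exactly when q ^ k divides n, so the factors move up by one place.
  -- The new first factor is q; the one that falls off at the end is 1, because q ^ (B + 1) > n.
  part-≡ : ∀ B {q} n .{{_ : NonZero n}} → Prime q → n ≤ B → part (suc B) q (q * n) ≡ q * part (suc B) q n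
  part-≡ B {q} n pq n≤B = begin
    ∏ (suc B) (λ k → ω q ^ ⟦ q ^ suc k ∣ q * n ⟧)
      ≡⟨ ∏-cong (suc B) (λ k _ → cong (ω q ^_) (⟦∣⟧-cong (*-cancelˡ-∣ q {{prime⇒nonZero pq}}) (*-monoʳ-∣ q))) ⟩
    ∏ (suc B) (λ k → ω q ^ ⟦ q ^ k ∣ n ⟧)
      ≡⟨ ∏-head B _ ⟩
    ω q ^ ⟦ 1 ∣ n ⟧ * ∏ B (λ k → ω q ^ ⟦ q ^ suc k ∣ n ⟧)
      ≡⟨ cong₂ _*_ (trans (cong (ω q ^_) (⟦∣⟧-yes (1∣ n))) (trans (^-identityʳ (ω q)) (ω-prime pq))) (sym last) ⟩
    q * ∏ (suc B) (λ k → ω q ^ ⟦ q ^ suc k ∣ n ⟧)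
      ∎
    where
    open ≡-Reasoning
    last : ∏ (suc B) (λ k → ω q ^ ⟦ q ^ suc k ∣ n ⟧) ≡ ∏ B (λ k → ω q ^ ⟦ q ^ suc k ∣ n ⟧)
    last = trans (cong (∏ B (λ k → ω q ^ ⟦ q ^ suc k ∣ n ⟧) *_)
        (cong (ω q ^_) (⟦∣⟧-no (>⇒∤ (<-trans (s≤s n≤B) (n<p^n pq (suc B)))))))
      (*-identityʳ _)

  -- Serves the induction over prime factors: multiplying n by a prime q changes only the factor
  -- with index q.
  ∏-scale : ∀ n {q} (f g : ℕ → ℕ) c → q < n → (∀ i → ¬ i ≡ q → f i ≡ g i) → f q ≡ c * g q → ∏ n f ≡ c * ∏ n g
  ∏-scale n {q} f g c q<n f≡g fq = begin
    ∏ n f                      ≡⟨ ∏-cong n (λ i _ → factor i) ⟩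
    ∏ n (λ i → δ i * g i)      ≡⟨ ∏-distrib-* n δ g ⟩
    ∏ n δ * ∏ n g              ≡⟨ cong (_* ∏ n g) (trans (∏-single n q δ q<n λ i _ → δ-≢ i) δ-q) ⟩
    c * ∏ n g                  ∎
    where
    open ≡-Reasoning
    δ : ℕ → ℕ
    δ i with i ≟ q
    ... | yes _ = c
    ... | no  _ = 1
    δ-≢ : ∀ i → ¬ i ≡ q → δ i ≡ 1
    δ-≢ i i≢q with i ≟ q
    ... | yes i≡q = contradiction i≡q i≢q
    ... | no  _   = refl
    δ-q : δ q ≡ c
    δ-q with q ≟ q
    ... | yes _   = refl
    ... | no q≢q  = contradiction refl q≢q
    factor : ∀ i → f i ≡ δ i * g i
    factor i with i ≟ q
    ... | yes refl = fq
    ... | no  i≢q  = trans (f≡g i i≢q) (sym (*-identityˡ (g i)))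

  Π-∣-product : ∀ B (qs : List ℕ) → All Prime qs → product qs ≤ B → Π (suc B) ⟦_∣ product qs ⟧ ≡ product qs
  Π-∣-product B [] [] _ = ∏-one (suc B) λ p _ → trans (∏-cong (suc B) λ k _ → refl) (one p)
    where
    one : ∀ p → part (suc B) p 1 ≡ 1
    one p with ω-cases p
    ... | inj₂ (_ , ω≡1) = ∏-one (suc B) λ k _ → trans (cong (_^ ⟦ p ^ suc k ∣ 1 ⟧) ω≡1) (^-zeroˡ ⟦ p ^ suc k ∣ 1 ⟧)
    ... | inj₁ (pp , _) = ∏-one (suc B) λ k _ → cong (ω p ^_)
      (⟦∣⟧-no {p ^ suc k} (>⇒∤ (≤-trans (s≤s (s≤s z≤n)) (n<p^n pp (suc k)))))
  Π-∣-product B (q ∷ qs) (pq ∷ pqs) qn≤B = begin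
    Π (suc B) ⟦_∣ q * n ⟧        ≡⟨ ∏-scale (suc B) (λ p → part (suc B) p (q * n)) (λ p → part (suc B) p n) q
                                       (s≤s (≤-trans (m≤m*n q n) qn≤B)) (λ p → part-≢ (suc B) n pq) (part-≡ B n pq n≤B) ⟩
    q * Π (suc B) ⟦_∣ n ⟧        ≡⟨ cong (q *_) (Π-∣-product B qs pqs n≤B) ⟩
    q * n                          ∎
    where
    open ≡-Reasoning
    n = product qs
    instance
      n≢0 : NonZero n
      n≢0 = productOfPrimes≢0 pqs
    n≤B : n ≤ B
    n≤B = ≤-trans (m≤n*m n q {{prime⇒nonZero pq}}) qn≤B

  -- The multiplicative form of log n = Σ Λ(d) over the divisors d of n.
  Π-∣ : ∀ B n .{{_ : NonZero n}} → n ≤ B → Π (suc B) ⟦_∣ n ⟧ ≡ n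
  Π-∣ B n n≤B = subst (λ m → Π (suc B) ⟦_∣ m ⟧ ≡ m) (sym eq)
    (Π-∣-product B factors factorsPrime (subst (_≤ B) eq n≤B))
    where
    open PrimeFactorisation (factorise n) renaming (isFactorisation to eq)

  -- Legendre's formula by induction: the new factor `suc n` contributes `⟦ d ∣ suc n ⟧` to the
  -- exponent, which is exactly the jump of the quotient by d.
  legendre : ∀ B n → n ≤ B → n ! ≡ Π (suc B) (n ÷_)
  legendre B zero _ = sym (trans (Π-cong (suc B) 0÷) (Π-0 (suc B)))
    where
    0÷ : ∀ d → 0 ÷ d ≡ 0
    0÷ zero    = refl
    0÷ (suc d) = 0/n≡0 (suc d)
  legendre B (suc n) n<B = begin
    suc n * n !                                          ≡⟨ cong₂ _*_ (sym (Π-∣ B (suc n) n<B)) (legendre B n (<⇒≤ n<B)) ⟩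
    Π (suc B) ⟦_∣ suc n ⟧ * Π (suc B) (n ÷_)           ≡⟨ Π-+ (suc B) ⟦_∣ suc n ⟧ (n ÷_) ⟨
    Π (suc B) (λ d → ⟦ d ∣ suc n ⟧ + n ÷ d)              ≡⟨ Π-cong (suc B) (suc-÷ n) ⟨
    Π (suc B) (suc n ÷_)                                 ∎
    where open ≡-Reasoning

-- Chebyshev's method: growth of multinomial coefficients

module Chebyshev where

  open import Data.Nat
  open import Data.Nat.Properties
  open import Data.Nat.DivMod
  open import Data.Nat.Induction using (<-rec)
  open import Data.Nat.Primality
  open import Data.Nat.Tactic.RingSolver using (solve-∀)
  open import Data.List using (List; []; _∷_)
  open import Data.List.Relation.Unary.All using (All; []; _∷_)
  open import Data.Product using (_×_; _,_)
  open import Data.Sum using (inj₁; inj₂)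
  open import Relation.Binary.PropositionalEquality
  open import Relation.Nullary using (¬_; yes; no; contradiction)
  open PrimeProducts

  ^-distribʳ-* : ∀ k m n → (m * n) ^ k ≡ m ^ k * n ^ k
  ^-distribʳ-* zero    m n = refl
  ^-distribʳ-* (suc k) m n = trans (cong (m * n *_) (^-distribʳ-* k m n)) ([m*n]*[o*p]≡[m*o]*[n*p] m n (m ^ k) (n ^ k))

  !-upper : ∀ k m → (k + m) ! ≤ m ! * (k + m) ^ k
  !-upper zero    m = ≤-reflexive (sym (*-identityʳ (m !)))
  !-upper (suc k) m = begin
    suc (k + m) * (k + m) !              ≤⟨ *-monoʳ-≤ (suc (k + m)) (!-upper k m) ⟩
    suc (k + m) * (m ! * (k + m) ^ k)    ≤⟨ *-monoʳ-≤ (suc (k + m)) (*-monoʳ-≤ (m !) (^-monoˡ-≤ k (n≤1+n (k + m)))) ⟩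
    suc (k + m) * (m ! * suc (k + m) ^ k) ≡⟨ swap (suc (k + m)) (m !) _ ⟩
    m ! * (suc (k + m) * suc (k + m) ^ k) ∎
    where
    open ≤-Reasoning
    swap : ∀ a b c → a * (b * c) ≡ b * (a * c)
    swap = solve-∀

  !-lower : ∀ k m → m ! * suc m ^ k ≤ (k + m) !
  !-lower zero    m = ≤-reflexive (*-identityʳ (m !))
  !-lower (suc k) m = begin
    m ! * (suc m * suc m ^ k)    ≡⟨ swap (m !) (suc m) _ ⟩
    suc m * (m ! * suc m ^ k)    ≤⟨ *-mono-≤ (s≤s (m≤n+m m k)) (!-lower k m) ⟩
    suc (k + m) * (k + m) !      ∎
    where
    open ≤-Reasoning
    swap : ∀ a b c → a * (b * c) ≡ b * (a * c)
    swap = solve-∀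

  -- The multinomial coefficient (kx)! / (x!) ^ k is at most k ^ (kx): passing from x to x + 1
  -- brings k new factors into (kx)!, each at most k (x + 1).
  [k*x]!-upper : ∀ k x → (k * x) ! ≤ (k ^ k) ^ x * (x !) ^ k
  [k*x]!-upper k zero = ≤-reflexive (trans (cong _! (*-zeroʳ k)) (sym (trans (+-identityʳ _) (^-zeroˡ k))))
  [k*x]!-upper k (suc x) = begin
    (k * suc x) !                                ≡⟨ cong _! (*-suc k x) ⟩
    (k + k * x) !                                ≤⟨ !-upper k (k * x) ⟩
    (k * x) ! * (k + k * x) ^ k                  ≡⟨ cong (λ y → (k * x) ! * y ^ k) (*-suc k x) ⟨
    (k * x) ! * (k * suc x) ^ k                  ≤⟨ *-monoˡ-≤ _ ([k*x]!-upper k x) ⟩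
    (k ^ k) ^ x * (x !) ^ k * (k * suc x) ^ k      ≡⟨ cong ((k ^ k) ^ x * (x !) ^ k *_) (^-distribʳ-* k k (suc x)) ⟩
    (k ^ k) ^ x * (x !) ^ k * (k ^ k * suc x ^ k)  ≡⟨ rearrange ((k ^ k) ^ x) ((x !) ^ k) (k ^ k) (suc x ^ k) ⟩
    k ^ k * (k ^ k) ^ x * (suc x ^ k * (x !) ^ k)  ≡⟨ cong (k ^ k * (k ^ k) ^ x *_) (^-distribʳ-* k (suc x) (x !)) ⟨
    k ^ k * (k ^ k) ^ x * (suc x * x !) ^ k      ∎
    where
    open ≤-Reasoning
    rearrange : ∀ a b c d → a * b * (c * d) ≡ c * a * (d * b)
    rearrange = solve-∀

  -- The same coefficient reaches k ^ (kx) up to a polynomial factor. The spare power for x is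
  -- dominated by the k new factors of the factorial, and (k (x + 1)) ^ k, slightly enlarged,
  -- becomes the spare power for x + 1.
  [k*x]!-lower : ∀ k x → (k ^ k) ^ x * (x !) ^ k ≤ (k * x) ! * suc (k * x) ^ k
  [k*x]!-lower k zero = ≤-reflexive (trans (trans (+-identityʳ _) (^-zeroˡ k))
    (sym (trans (cong (λ y → y ! * suc y ^ k) (*-zeroʳ k)) (trans (+-identityʳ _) (^-zeroˡ k)))))
  [k*x]!-lower k (suc x) = begin
    k ^ k * (k ^ k) ^ x * (suc x * x !) ^ k            ≡⟨ cong (k ^ k * (k ^ k) ^ x *_) (^-distribʳ-* k (suc x) (x !)) ⟩
    k ^ k * (k ^ k) ^ x * (suc x ^ k * (x !) ^ k)        ≡⟨ rearrange ((k ^ k) ^ x) ((x !) ^ k) (k ^ k) (suc x ^ k) ⟨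
    (k ^ k) ^ x * (x !) ^ k * (k ^ k * suc x ^ k)        ≡⟨ cong ((k ^ k) ^ x * (x !) ^ k *_) (^-distribʳ-* k k (suc x)) ⟨
    (k ^ k) ^ x * (x !) ^ k * (k * suc x) ^ k            ≤⟨ *-mono-≤ ([k*x]!-lower k x) (^-monoˡ-≤ k (n≤1+n (k * suc x))) ⟩
    (k * x) ! * suc (k * x) ^ k * suc (k * suc x) ^ k  ≤⟨ *-monoˡ-≤ _ (!-lower k (k * x)) ⟩
    (k + k * x) ! * suc (k * suc x) ^ k                ≡⟨ cong (λ y → y ! * suc (k * suc x) ^ k) (*-suc k x) ⟨
    (k * suc x) ! * suc (k * suc x) ^ k                ∎
    where
    open ≤-Reasoning
    rearrange : ∀ a b c d → a * b * (c * d) ≡ c * a * (d * b)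
    rearrange = solve-∀

  -- An upper bound for exp ψ

  sg : ℕ → ℕ
  sg zero    = 0
  sg (suc _) = 1

  sg-mono : ∀ {m n} → m ≤ n → sg m ≤ sg n
  sg-mono z≤n     = z≤n
  sg-mono (s≤s _) = s≤s z≤n

  sg≤1 : ∀ n → sg n ≤ 1
  sg≤1 zero    = z≤n
  sg≤1 (suc _) = ≤-refl

  sg-pos : ∀ {n} → 0 < n → sg n ≡ 1
  sg-pos (s≤s _) = refl

  ÷-pos : ∀ {n} d .{{_ : NonZero d}} → d ≤ n → 0 < n ÷ d
  ÷-pos (suc d) d≤n = m≥n⇒m/n>0 d≤n

  ÷-shrinks : ∀ n d → 1 ≤ n → 1 < d → n ÷ d < n
  ÷-shrinks n (suc d) 1≤n 1<d = m/n<m n (suc d) {{>-nonZero 1≤n}} 1<d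

  -- exp of Chebyshev's ψ(n), for any B > n.
  expψ : ℕ → ℕ → ℕ
  expψ B n = Π B (λ d → sg (n ÷ d))

  expψ-1 : ∀ B → expψ B 1 ≡ 1
  expψ-1 B = ∏-one B λ p _ → ∏-one B λ k _ → one p k
    where
    one : ∀ p k → ω p ^ sg (1 ÷ (p ^ suc k)) ≡ 1
    one p k with ω-cases p
    ... | inj₂ (_ , ω≡1) = trans (cong (_^ sg (1 ÷ (p ^ suc k))) ω≡1) (^-zeroˡ (sg (1 ÷ (p ^ suc k))))
    ... | inj₁ (pp , _)  = cong (λ q → ω p ^ sg q) (÷-small (≤-trans (s≤s (s≤s z≤n)) (n<p^n pp (suc k))))

  -- Compare (2x)! with x!² prime power by prime power: ⌊q⌋ - 2⌊q/2⌋ is 1 at q = 1 and never negative.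
  expψ-double : ∀ B x → 2 * x ≤ B → expψ (suc B) (2 * x) ≤ 4 ^ x * expψ (suc B) x
  expψ-double B x 2x≤B = *-cancelˡ-≤ ((x !) ^ 2) {{m^n≢0 (x !) 2 {{x!≢0}}}} (begin
    (x !) ^ 2 * expψ (suc B) (2 * x)
      ≡⟨ cong (_* expψ (suc B) (2 * x)) (trans (cong (_^ 2) (legendre B x (≤-trans (m≤n*m x 2) 2x≤B))) (sym (Π-*ˡ (suc B) 2 (x ÷_)))) ⟩
    Π (suc B) (λ d → 2 * (x ÷ d)) * expψ (suc B) (2 * x)
      ≡⟨ Π-+ (suc B) (λ d → 2 * (x ÷ d)) (λ d → sg ((2 * x) ÷ d)) ⟨
    Π (suc B) (λ d → 2 * (x ÷ d) + sg ((2 * x) ÷ d))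
      ≤⟨ Π-mono (suc B) (λ d → subst (λ y → 2 * y + sg ((2 * x) ÷ d) ≤ (2 * x) ÷ d + sg y) (half d) (pointwise ((2 * x) ÷ d))) ⟩
    Π (suc B) (λ d → (2 * x) ÷ d + sg (x ÷ d))
      ≡⟨ Π-+ (suc B) ((2 * x) ÷_) (λ d → sg (x ÷ d)) ⟩
    Π (suc B) ((2 * x) ÷_) * expψ (suc B) x
      ≡⟨ cong (_* expψ (suc B) x) (legendre B (2 * x) 2x≤B) ⟨
    (2 * x) ! * expψ (suc B) x
      ≤⟨ *-monoˡ-≤ _ ([k*x]!-upper 2 x) ⟩
    4 ^ x * (x !) ^ 2 * expψ (suc B) x
      ≡⟨ swap (4 ^ x) ((x !) ^ 2) _ ⟩
    (x !) ^ 2 * (4 ^ x * expψ (suc B) x) ∎)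
    where
    open ≤-Reasoning
    x!≢0 : NonZero (x !)
    x!≢0 = x !≢0
    swap : ∀ a b c → a * b * c ≡ b * (a * c)
    swap = solve-∀
    half : ∀ d → (2 * x) ÷ d ÷ 2 ≡ x ÷ d
    half d = trans (÷-comm (2 * x) d 2) (cong (_÷ d) (trans (cong (_÷ 2) (*-comm 2 x)) (m*n÷n≡m x 2)))
    pointwise : ∀ q → 2 * (q ÷ 2) + sg q ≤ q + sg (q ÷ 2)
    pointwise 0 = z≤n
    pointwise 1 = ≤-refl
    pointwise q@(suc (suc _)) = +-mono-≤ (≤-trans (≤-reflexive (*-comm 2 (q / 2))) (m/n*n≤m q 2))
      (≤-reflexive (sym (sg-pos (m≥n⇒m/n>0 {q} {2} (s≤s (s≤s z≤n))))))

  ⌈n/2⌉≤1+⌊n/2⌋ : ∀ n → ⌈ n /2⌉ ≤ suc ⌊ n /2⌋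
  ⌈n/2⌉≤1+⌊n/2⌋ zero          = z≤n
  ⌈n/2⌉≤1+⌊n/2⌋ (suc zero)    = ≤-refl
  ⌈n/2⌉≤1+⌊n/2⌋ (suc (suc n)) = s≤s (⌈n/2⌉≤1+⌊n/2⌋ n)

  3*⌈n/2⌉≤2*n : ∀ n → 3 * ⌈ 2 + n /2⌉ ≤ 2 * (2 + n)
  3*⌈n/2⌉≤2*n 0 = n≤1+n 3
  3*⌈n/2⌉≤2*n 1 = ≤-refl
  3*⌈n/2⌉≤2*n (suc (suc n)) = begin
    3 * suc ⌈ 2 + n /2⌉  ≡⟨ *-suc 3 ⌈ 2 + n /2⌉ ⟩
    3 + 3 * ⌈ 2 + n /2⌉  ≤⟨ +-mono-≤ (n≤1+n 3) (3*⌈n/2⌉≤2*n n) ⟩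
    4 + 2 * (2 + n)      ≡⟨ *-distribˡ-+ 2 2 (2 + n) ⟨
    2 * (2 + (2 + n))    ∎
    where open ≤-Reasoning

  -- Halving with x = ⌈n/2⌉ gives a factor 4 ^ x. Rounding up costs most at n = 3, where x = 2n/3,
  -- and 16 is the least base C with (4 C) ^ (2/3) ≤ C.
  expψ≤16^ : ∀ B n → n < B → 1 ≤ n → expψ (suc B) n ≤ 16 ^ n
  expψ≤16^ B = <-rec _ λ where
    1 _ _ _ → ≤-trans (≤-reflexive (expψ-1 (suc B))) (s≤s z≤n)
    n@(suc (suc n-2)) rec n<B _ → let
        x = ⌈ n /2⌉
        open ≤-Reasoning
        x<n : x < n
        x<n = ⌈n/2⌉<n n-2
        n≤2x : n ≤ 2 * x
        n≤2x = ≤-trans (≤-reflexive (sym (⌊n/2⌋+⌈n/2⌉≡n n)))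
          (≤-trans (+-monoˡ-≤ x (⌊n/2⌋≤⌈n/2⌉ n)) (≤-reflexive (cong (x +_) (sym (+-identityʳ x)))))
        2x≤1+n : 2 * x ≤ suc n
        2x≤1+n = ≤-trans (≤-reflexive (cong (x +_) (+-identityʳ x)))
          (≤-trans (+-monoˡ-≤ x (⌈n/2⌉≤1+⌊n/2⌋ n)) (≤-reflexive (cong suc (⌊n/2⌋+⌈n/2⌉≡n n))))
        3x≤2n : 3 * x ≤ 2 * n
        3x≤2n = 3*⌈n/2⌉≤2*n n-2
      in begin
        expψ (suc B) n                 ≤⟨ Π-mono (suc B) (λ d → sg-mono (÷-mono d n≤2x)) ⟩
        expψ (suc B) (2 * x)           ≤⟨ expψ-double B x (≤-trans 2x≤1+n n<B) ⟩
        4 ^ x * expψ (suc B) x         ≤⟨ *-monoʳ-≤ (4 ^ x) (rec x<n (<-trans x<n n<B) (s≤s z≤n)) ⟩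
        4 ^ x * 16 ^ x                 ≡⟨ cong (4 ^ x *_) (^-*-assoc 4 2 x) ⟩
        4 ^ x * 4 ^ (2 * x)            ≡⟨ ^-distribˡ-+-* 4 x (2 * x) ⟨
        4 ^ (3 * x)                    ≤⟨ ^-monoʳ-≤ 4 3x≤2n ⟩
        4 ^ (2 * n)                    ≡⟨ ^-*-assoc 4 2 n ⟨
        16 ^ n                         ∎

  -- Trailing factors equal to 1 are dropped until p ^ (j + 1) ≤ N; then bounding each of the j + 1
  -- factors by p suffices.
  prime-powers≤ : ∀ {p} N j → Prime p → 1 ≤ N → ∏ j (λ k → p ^ sg (N ÷ (p ^ suc k))) ≤ N
  prime-powers≤ {p} N zero pp 1≤N = 1≤N
  prime-powers≤ {p} N (suc j) pp 1≤N with p ^ suc j ≤? N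
  ... | no  pʲ⁺¹≰N = subst (λ q → ∏ j (λ k → p ^ sg (N ÷ (p ^ suc k))) * p ^ sg q ≤ N) (sym (÷-small (≰⇒> pʲ⁺¹≰N)))
    (≤-trans (≤-reflexive (*-identityʳ _)) (prime-powers≤ N j pp 1≤N))
  ... | yes pʲ⁺¹≤N = ≤-trans
    (∏-mono (suc j) λ k _ → ≤-trans (^-monoʳ-≤ p {{prime⇒nonZero pp}} (sg≤1 (N ÷ (p ^ suc k)))) (≤-reflexive (*-identityʳ p)))
    (≤-trans (≤-reflexive (∏-const (suc j) p)) pʲ⁺¹≤N)

  ∏-supported : ∀ B s N (f : ℕ → ℕ) → 1 ≤ N → (∀ p → f p ≤ N) → (∀ p → s ≤ p → f p ≡ 1) → ∏ B f ≤ N ^ s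
  ∏-supported zero s N f 1≤N f≤N f≡1 = m^n>0 N {{>-nonZero 1≤N}} s
  ∏-supported (suc B) s N f 1≤N f≤N f≡1 with s ≤? B
  ... | yes s≤B = begin
    ∏ B f * f B  ≡⟨ cong (∏ B f *_) (f≡1 B s≤B) ⟩
    ∏ B f * 1    ≡⟨ *-identityʳ _ ⟩
    ∏ B f        ≤⟨ ∏-supported B s N f 1≤N f≤N f≡1 ⟩
    N ^ s        ∎
    where open ≤-Reasoning
  ... | no s≰B = begin
    ∏ (suc B) f           ≤⟨ ∏-mono (suc B) (λ p _ → f≤N p) ⟩
    ∏ (suc B) (λ _ → N)   ≡⟨ ∏-const (suc B) N ⟩
    N ^ suc B             ≤⟨ ^-monoʳ-≤ N {{>-nonZero 1≤N}} (≰⇒> s≰B) ⟩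
    N ^ s                 ∎
    where open ≤-Reasoning

  δ : ℕ → ℕ → ℕ
  δ u q with q ≟ u
  ... | yes _ = 1
  ... | no  _ = 0

  δ≤sg : ∀ u q → 1 ≤ u → δ u q ≤ sg q
  δ≤sg u q 1≤u with q ≟ u
  ... | yes refl = ≤-reflexive (sym (sg-pos 1≤u))
  ... | no _ = z≤n

  δ-≢ : ∀ {u q} → ¬ q ≡ u → δ u q ≡ 0
  δ-≢ {u} {q} q≢u with q ≟ u
  ... | yes q≡u = contradiction q≡u q≢u
  ... | no _ = refl

  -- If no prime p has ⌊N/p⌋ = u, then only the higher powers p ^ k with p < √N contribute.
  Π-δ≤ : ∀ B N u s → 1 ≤ u → 1 ≤ N → (∀ p → Prime p → ¬ N ÷ p ≡ u) → (∀ p → s ≤ p → N < p * p) →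
         Π B (λ d → δ u (N ÷ d)) ≤ N ^ s
  Π-δ≤ B N u s 1≤u 1≤N noPrime large = ∏-supported B s N _ 1≤N bounded trivial
    where
    bounded : ∀ p → ∏ B (λ k → ω p ^ δ u (N ÷ (p ^ suc k))) ≤ N
    bounded p with ω-cases p
    ... | inj₂ (_ , ω≡1) = ≤-trans (≤-reflexive (∏-one B λ k _ →
      trans (cong (_^ δ u (N ÷ (p ^ suc k))) ω≡1) (^-zeroˡ (δ u (N ÷ (p ^ suc k)))))) 1≤N
    ... | inj₁ (pp , ω≡p) = ≤-trans (∏-mono B λ k _ → ≤-trans
        (≤-reflexive (cong (_^ δ u (N ÷ (p ^ suc k))) ω≡p))
        (^-monoʳ-≤ p {{prime⇒nonZero pp}} (δ≤sg u (N ÷ (p ^ suc k)) 1≤u)))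
      (prime-powers≤ N B pp 1≤N)
    trivial : ∀ p → s ≤ p → ∏ B (λ k → ω p ^ δ u (N ÷ (p ^ suc k))) ≡ 1
    trivial p s≤p with ω-cases p
    ... | inj₂ (_ , ω≡1) = ∏-one B λ k _ →
      trans (cong (_^ δ u (N ÷ (p ^ suc k))) ω≡1) (^-zeroˡ (δ u (N ÷ (p ^ suc k))))
    ... | inj₁ (pp , _) = ∏-one B λ k _ → cong (ω p ^_) (zero-exponent k)
      where
      zero-exponent : ∀ k → δ u (N ÷ (p ^ suc k)) ≡ 0
      zero-exponent zero = δ-≢ (subst (λ d → ¬ N ÷ d ≡ u) (sym (*-identityʳ p)) (noPrime p pp))
      zero-exponent (suc k) = δ-≢ λ eq → contradiction (trans (sym eq) (÷-small N<pᵏ⁺²)) (>⇒≢ 1≤u)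
        where
        N<pᵏ⁺² : N < p ^ suc (suc k)
        N<pᵏ⁺² = <-≤-trans (large p s≤p) (*-monoʳ-≤ p (m≤m*n p (p ^ k) {{m^n≢0 p k {{prime⇒nonZero pp}}}}))

  -- Balanced products of factorials and what a prime gap would imply

  ^-regroup : ∀ c k w x g a y → (a ^ x * y ^ k) ^ c * (g ^ x * y ^ w) ≡ (a ^ c * g) ^ x * y ^ (c * k + w)
  ^-regroup c k w x g a y = begin
    (a ^ x * y ^ k) ^ c * (g ^ x * y ^ w)
      ≡⟨ cong (_* (g ^ x * y ^ w)) (^-distribʳ-* c (a ^ x) (y ^ k)) ⟩
    (a ^ x) ^ c * (y ^ k) ^ c * (g ^ x * y ^ w)
      ≡⟨ cong₂ (λ u v → u * v * (g ^ x * y ^ w))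
           (trans (^-*-assoc a x c) (trans (cong (a ^_) (*-comm x c)) (sym (^-*-assoc a c x))))
           (trans (^-*-assoc y k c) (cong (y ^_) (*-comm k c))) ⟩
    (a ^ c) ^ x * y ^ (c * k) * (g ^ x * y ^ w)
      ≡⟨ [m*n]*[o*p]≡[m*o]*[n*p] ((a ^ c) ^ x) (y ^ (c * k)) (g ^ x) (y ^ w) ⟩
    (a ^ c) ^ x * g ^ x * (y ^ (c * k) * y ^ w)
      ≡⟨ cong₂ _*_ (^-distribʳ-* x (a ^ c) g) (^-distribˡ-+-* y (c * k) w) ⟨
    (a ^ c * g) ^ x * y ^ (c * k + w) ∎
    where open ≡-Reasoning

  -- A combination Σ c ⌊q/b⌋ is a list of pairs (c , b), where every b divides L.
  Combination : Set
  Combination = List (ℕ × ℕ)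

  module _ (L : ℕ) where

    Valid : Combination → Set
    Valid = All λ (_ , b) → NonZero b × (L ÷ b * b ≡ L)

    eval : Combination → ℕ → ℕ
    eval []             q = 0
    eval ((c , b) ∷ cs) q = c * (q ÷ b) + eval cs q

    -- L Σ c / b, so two combinations of equal weight form a difference with Σ c / b = 0.
    weight : Combination → ℕ
    weight []             = 0
    weight ((c , b) ∷ cs) = c * (L ÷ b) + weight cs

    -- The exponential rate, per unit of x, of the product of the (x L / b)! ^ c once (x !) ^ weight
    -- is divided out.
    growth : Combination → ℕ
    growth []             = 1
    growth ((c , b) ∷ cs) = ((L ÷ b) ^ (L ÷ b)) ^ c * growth cs

    factorials : Combination → ℕ → ℕ
    factorials []             x = 1
    factorials ((c , b) ∷ cs) x = ((L ÷ b * x) !) ^ c * factorials cs x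

    -- Makes the difference of two combinations of equal weight periodic with period L, so that a
    -- check of finitely many q settles all of them.
    eval-period : ∀ {cs} → Valid cs → ∀ q j → eval cs (q + j * L) ≡ eval cs q + j * weight cs
    eval-period [] q j = sym (*-zeroʳ j)
    eval-period {(c , b) ∷ cs} ((b≢0 , b∣L) ∷ valid) q j = begin
      c * ((q + j * L) ÷ b) + eval cs (q + j * L)
        ≡⟨ cong₂ (λ y z → c * y + z) shifted (eval-period valid q j) ⟩
      c * (q ÷ b + j * (L ÷ b)) + (eval cs q + j * weight cs)
        ≡⟨ rearrange c (q ÷ b) j (L ÷ b) (eval cs q) (weight cs) ⟩
      c * (q ÷ b) + eval cs q + j * (c * (L ÷ b) + weight cs) ∎
      where
      open ≡-Reasoning
      rearrange : ∀ c y j z u v → c * (y + j * z) + (u + j * v) ≡ c * y + u + j * (c * z + v)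
      rearrange = solve-∀
      shifted : (q + j * L) ÷ b ≡ q ÷ b + j * (L ÷ b)
      shifted = trans (cong (λ y → (q + y) ÷ b) (trans (cong (j *_) (sym b∣L)) (sym (*-assoc j (L ÷ b) b))))
        (+-*-÷ q (j * (L ÷ b)) b {{b≢0}})

    -- Since ⌊⌊N / b⌋ / d⌋ = ⌊⌊N / d⌋ / b⌋ for N = x L, the exponent at d depends on ⌊N / d⌋ alone.
    factorials-Π : ∀ {cs} → Valid cs → ∀ x → factorials cs x ≡ Π (suc (x * L)) (λ d → eval cs (x * L ÷ d))
    factorials-Π [] x = sym (Π-0 (suc (x * L)))
    factorials-Π {(c , b) ∷ cs} ((b≢0 , b∣L) ∷ valid) x = begin
      ((L ÷ b * x) !) ^ c * factorials cs x
        ≡⟨ cong₂ (λ y z → y ^ c * z) (legendre (x * L) (L ÷ b * x) bound) (factorials-Π valid x) ⟩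
      Π B ((L ÷ b * x) ÷_) ^ c * Π B (λ d → eval cs (x * L ÷ d))
        ≡⟨ cong (_* Π B (λ d → eval cs (x * L ÷ d))) (Π-*ˡ B c ((L ÷ b * x) ÷_)) ⟨
      Π B (λ d → c * ((L ÷ b * x) ÷ d)) * Π B (λ d → eval cs (x * L ÷ d))
        ≡⟨ Π-+ B (λ d → c * ((L ÷ b * x) ÷ d)) (λ d → eval cs (x * L ÷ d)) ⟨
      Π B (λ d → c * ((L ÷ b * x) ÷ d) + eval cs (x * L ÷ d))
        ≡⟨ Π-cong B (λ d → cong (λ y → c * y + eval cs (x * L ÷ d)) (trans (cong (_÷ d) (sym xL÷b)) (÷-comm (x * L) b d))) ⟩
      Π B (λ d → c * (x * L ÷ d ÷ b) + eval cs (x * L ÷ d)) ∎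
      where
      open ≡-Reasoning
      B = suc (x * L)
      xL : x * L ≡ L ÷ b * x * b
      xL = trans (cong (x *_) (sym b∣L)) (move x (L ÷ b) b)
        where
        move : ∀ x y b → x * (y * b) ≡ y * x * b
        move = solve-∀
      xL÷b : x * L ÷ b ≡ L ÷ b * x
      xL÷b = trans (cong (_÷ b) xL) (m*n÷n≡m (L ÷ b * x) b {{b≢0}})
      bound : L ÷ b * x ≤ x * L
      bound = ≤-trans (m≤m*n (L ÷ b * x) b {{b≢0}}) (≤-reflexive (sym xL))

    factorials-upper : ∀ cs x → factorials cs x ≤ growth cs ^ x * (x !) ^ weight cs
    factorials-upper [] x = ≤-reflexive (sym (trans (*-identityʳ _) (^-zeroˡ x)))
    factorials-upper ((c , b) ∷ cs) x = begin
      ((k * x) !) ^ c * factorials cs x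
        ≤⟨ *-mono-≤ (^-monoˡ-≤ c ([k*x]!-upper k x)) (factorials-upper cs x) ⟩
      ((k ^ k) ^ x * (x !) ^ k) ^ c * (growth cs ^ x * (x !) ^ weight cs)
        ≡⟨ ^-regroup c k (weight cs) x (growth cs) (k ^ k) (x !) ⟩
      ((k ^ k) ^ c * growth cs) ^ x * (x !) ^ (c * k + weight cs) ∎
      where
      open ≤-Reasoning
      k = L ÷ b

    factorials-lower : ∀ {cs} → Valid cs → ∀ x →
      growth cs ^ x * (x !) ^ weight cs ≤ factorials cs x * suc (x * L) ^ weight cs
    factorials-lower [] x = ≤-reflexive (cong (_* 1) (^-zeroˡ x))
    factorials-lower {(c , b) ∷ cs} ((b≢0 , b∣L) ∷ valid) x = begin
      ((k ^ k) ^ c * growth cs) ^ x * (x !) ^ (c * k + weight cs)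
        ≡⟨ ^-regroup c k (weight cs) x (growth cs) (k ^ k) (x !) ⟨
      ((k ^ k) ^ x * (x !) ^ k) ^ c * (growth cs ^ x * (x !) ^ weight cs)
        ≤⟨ *-mono-≤ (^-monoˡ-≤ c (≤-trans ([k*x]!-lower k x) (*-monoʳ-≤ ((k * x) !) (^-monoˡ-≤ k (s≤s bound)))))
                    (factorials-lower valid x) ⟩
      ((k * x) ! * N ^ k) ^ c * (factorials cs x * N ^ weight cs)
        ≡⟨ cong (_* (factorials cs x * N ^ weight cs))
             (trans (^-distribʳ-* c ((k * x) !) (N ^ k))
               (cong (((k * x) !) ^ c *_) (trans (^-*-assoc N k c) (cong (N ^_) (*-comm k c))))) ⟩
      ((k * x) !) ^ c * N ^ (c * k) * (factorials cs x * N ^ weight cs)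
        ≡⟨ [m*n]*[o*p]≡[m*o]*[n*p] (((k * x) !) ^ c) (N ^ (c * k)) (factorials cs x) (N ^ weight cs) ⟩
      ((k * x) !) ^ c * factorials cs x * (N ^ (c * k) * N ^ weight cs)
        ≡⟨ cong (((k * x) !) ^ c * factorials cs x *_) (^-distribˡ-+-* N (c * k) (weight cs)) ⟨
      ((k * x) !) ^ c * factorials cs x * N ^ (c * k + weight cs) ∎
      where
      open ≤-Reasoning
      k = L ÷ b
      N = suc (x * L)
      bound : k * x ≤ x * L
      bound = begin
        k * x      ≤⟨ m≤m*n (k * x) b {{b≢0}} ⟩
        k * x * b  ≡⟨ move k x b ⟩
        x * (k * b) ≡⟨ cong (x *_) b∣L ⟩
        x * L      ∎
        where
        move : ∀ k x b → k * x * b ≡ x * (k * b)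
        move = solve-∀

    module _ {pos neg : Combination} (valid⁺ : Valid pos) (valid⁻ : Valid neg) (balanced : weight pos ≡ weight neg)
             {u K m : ℕ} .{{_ : NonZero K}} .{{_ : NonZero L}} (1≤u : 1 ≤ u) (1<K : 1 < K) (K≤L : K ≤ L)
             (dominated : ∀ {q} → q < L → eval pos q ≤ eval neg q + m * (δ u q + sg (q ÷ K)))
             (bounded : ∀ {q} → q < L → eval pos q ≤ eval neg q + m) where

      -- From L on the tail term is constantly 1, because K ≤ L, and the periodic bound by m is all
      -- that is needed there.
      dominated-everywhere : ∀ q → eval pos q ≤ eval neg q + m * (δ u q + sg (q ÷ K))
      dominated-everywhere q with q <? L
      ... | yes q<L = dominated q<L
      ... | no  q≮L = begin
        eval pos q                                 ≡⟨ cong (eval pos) q≡ ⟩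
        eval pos (r + j * L)                       ≡⟨ eval-period valid⁺ r j ⟩
        eval pos r + j * weight pos                ≤⟨ +-mono-≤ (bounded (m%n<n q L)) (≤-reflexive (cong (j *_) balanced)) ⟩
        eval neg r + m + j * weight neg            ≡⟨ rearrange (eval neg r) m (j * weight neg) ⟩
        eval neg r + j * weight neg + m * 1        ≡⟨ cong (_+ m * 1) (trans (cong (eval neg) q≡) (eval-period valid⁻ r j)) ⟨
        eval neg q + m * 1                         ≡⟨ cong (λ y → eval neg q + m * y) (sg-pos q÷K>0) ⟨
        eval neg q + m * sg (q ÷ K)                ≤⟨ +-monoʳ-≤ (eval neg q) (*-monoʳ-≤ m (m≤n+m (sg (q ÷ K)) (δ u q))) ⟩
        eval neg q + m * (δ u q + sg (q ÷ K))      ∎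
        where
        open ≤-Reasoning
        r = q % L
        j = q / L
        q≡ : q ≡ r + j * L
        q≡ = m≡m%n+[m/n]*n q L
        rearrange : ∀ a m b → a + m + b ≡ a + b + m * 1
        rearrange = solve-∀
        q÷K>0 : 0 < q ÷ K
        q÷K>0 = ÷-pos K (≤-trans K≤L (≮⇒≥ q≮L))

      -- Both products of factorials are compared exponent by exponent, and balance cancels (x !) ^
      -- weight. Without a prime in the critical range, the excess growth has to be paid by the
      -- primes below `s` (at most `N ^ s`) and the prime powers up to N / K (at most
      -- `16 ^ (N ÷ K)`), both to the power m, and by the polynomial loss of `factorials-lower`.
      prime-gap-bound : ∀ x s → 1 ≤ x → (∀ p → Prime p → ¬ x * L ÷ p ≡ u) → (∀ p → s ≤ p → x * L < p * p) →
        growth pos ^ x ≤ growth neg ^ x * (((x * L) ^ s * 16 ^ (x * L ÷ K)) ^ m * suc (x * L) ^ weight neg)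
      prime-gap-bound x s 1≤x noPrime large = *-cancelʳ-≤ _ _ ((x !) ^ weight neg) {{m^n≢0 (x !) (weight neg) {{x !≢0}}}} (begin
        growth pos ^ x * (x !) ^ weight neg
          ≡⟨ cong (λ w → growth pos ^ x * (x !) ^ w) balanced ⟨
        growth pos ^ x * (x !) ^ weight pos
          ≤⟨ factorials-lower valid⁺ x ⟩
        factorials pos x * suc N ^ weight pos
          ≡⟨ cong₂ (λ y w → y * suc N ^ w) (factorials-Π valid⁺ x) balanced ⟩
        Π B (λ d → eval pos (N ÷ d)) * suc N ^ weight neg
          ≤⟨ *-monoˡ-≤ (suc N ^ weight neg) (Π-mono B λ d → dominated-everywhere (N ÷ d)) ⟩
        Π B (λ d → eval neg (N ÷ d) + m * error d) * suc N ^ weight neg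
          ≡⟨ cong (_* suc N ^ weight neg) (Π-+ B (λ d → eval neg (N ÷ d)) (λ d → m * error d)) ⟩
        Π B (λ d → eval neg (N ÷ d)) * Π B (λ d → m * error d) * suc N ^ weight neg
          ≡⟨ cong₂ (λ y z → y * z * suc N ^ weight neg) (sym (factorials-Π valid⁻ x)) (Π-*ˡ B m error) ⟩
        factorials neg x * Π B error ^ m * suc N ^ weight neg
          ≤⟨ *-monoˡ-≤ (suc N ^ weight neg) (*-mono-≤ (factorials-upper neg x) (^-monoˡ-≤ m error-bound)) ⟩
        growth neg ^ x * (x !) ^ weight neg * (N ^ s * 16 ^ (N ÷ K)) ^ m * suc N ^ weight neg
          ≡⟨ rearrange (growth neg ^ x) ((x !) ^ weight neg) ((N ^ s * 16 ^ (N ÷ K)) ^ m) (suc N ^ weight neg) ⟩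
        growth neg ^ x * ((N ^ s * 16 ^ (N ÷ K)) ^ m * suc N ^ weight neg) * (x !) ^ weight neg ∎)
        where
        open ≤-Reasoning
        N = x * L
        B = suc N
        1≤N : 1 ≤ N
        1≤N = ≤-trans 1≤x (m≤m*n x L)
        rearrange : ∀ a b c d → a * b * c * d ≡ a * (c * d) * b
        rearrange = solve-∀
        error : ℕ → ℕ
        error d = δ u (N ÷ d) + sg (N ÷ d ÷ K)
        tail-bound : expψ B (N ÷ K) ≤ 16 ^ (N ÷ K)
        tail-bound = expψ≤16^ N (N ÷ K) (÷-shrinks N K 1≤N 1<K) (÷-pos K (≤-trans K≤L (m≤n*m L x {{>-nonZero 1≤x}})))
        error-bound : Π B error ≤ N ^ s * 16 ^ (N ÷ K)
        error-bound = begin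
          Π B error
            ≡⟨ Π-+ B (λ d → δ u (N ÷ d)) (λ d → sg (N ÷ d ÷ K)) ⟩
          Π B (λ d → δ u (N ÷ d)) * Π B (λ d → sg (N ÷ d ÷ K))
            ≡⟨ cong (Π B (λ d → δ u (N ÷ d)) *_) (Π-cong B λ d → cong sg (÷-comm N d K)) ⟩
          Π B (λ d → δ u (N ÷ d)) * expψ B (N ÷ K)
            ≤⟨ *-mono-≤ (Π-δ≤ B N u s 1≤u 1≤N noPrime large) tail-bound ⟩
          N ^ s * 16 ^ (N ÷ K) ∎

-- A prime between 560 x and 630 x

module PrimesInIntervals where

  open import Data.Nat
  open import Data.Nat.Properties
  open import Data.Nat.DivMod
  open import Data.Nat.Primality
  open import Data.Nat.Tactic.RingSolver using (solve-∀)
  open import Data.Empty using (⊥-elim)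
  open import Data.List using ([]; _∷_)
  open import Data.List.Relation.Unary.All using (all?)
  open import Data.Product using (_×_; _,_; ∃; proj₁)
  open import Data.Unit using (tt)
  open import Relation.Binary.PropositionalEquality
  open import Relation.Nullary using (¬_; Dec; yes; no; contradiction)
  open import Relation.Nullary.Decidable using (toWitness; _×-dec_)
  open PrimeProducts
  open Chebyshev

  pos neg : Combination
  pos = (2 , 8) ∷ (2 , 18) ∷ (2 , 28) ∷ (2 , 45) ∷ (2 , 48) ∷ (2 , 63) ∷ (2 , 80) ∷ (2 , 112) ∷ (2 , 120) ∷
        (5 , 168) ∷ (5 , 280) ∷ (1 , 360) ∷ (4 , 420) ∷ (3 , 630) ∷ (4 , 1008) ∷ (1 , 1260) ∷ (5 , 1680) ∷
        (2 , 2520) ∷ []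
  neg = (2 , 9) ∷ (2 , 16) ∷ (2 , 24) ∷ (2 , 40) ∷ (4 , 56) ∷ (2 , 84) ∷ (2 , 90) ∷ (2 , 126) ∷ (2 , 140) ∷
        (2 , 144) ∷ (1 , 180) ∷ (2 , 240) ∷ (1 , 315) ∷ (3 , 336) ∷ (1 , 504) ∷ (2 , 560) ∷ (8 , 840) ∷ []

  valid? : ∀ L cs → Dec (Valid L cs)
  valid? L = all? λ (_ , b) → nonZero? b ×-dec (L ÷ b * b ≟ L)

  pos-valid : Valid 5040 pos
  pos-valid = toWitness {a? = valid? 5040 pos} tt

  neg-valid : Valid 5040 neg
  neg-valid = toWitness {a? = valid? 5040 neg} tt

  pos-dominated : ∀ {q} → q < 5040 → eval 5040 pos q ≤ eval 5040 neg q + 2 * (δ 8 q + sg (q ÷ 2016))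
  pos-dominated = toWitness {a? = allUpTo? (λ q → eval 5040 pos q ≤? eval 5040 neg q + 2 * (δ 8 q + sg (q ÷ 2016))) 5040} tt

  pos-bounded : ∀ {q} → q < 5040 → eval 5040 pos q ≤ eval 5040 neg q + 2
  pos-bounded = toWitness {a? = allUpTo? (λ q → eval 5040 pos q ≤? eval 5040 neg q + 2) 5040} tt

  growth-gap : growth 5040 neg * 2 ^ 25 ≤ growth 5040 pos
  growth-gap = ≤ᵇ⇒≤ _ _ tt

  growth-nonZero : NonZero (growth 5040 neg)
  growth-nonZero = _

  weight-neg≤ : weight 5040 neg ≤ 2 ^ 12
  weight-neg≤ = ≤ᵇ⇒≤ _ _ tt

  power-bracket : ∀ b x → 1 < b → 1 ≤ x → ∃ λ h → b ^ h ≤ x × x < b ^ suc h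
  power-bracket b (suc zero) 1<b _ = 0 , ≤-refl , ≤-trans 1<b (≤-reflexive (sym (*-identityʳ b)))
  power-bracket b (suc x@(suc _)) 1<b _ with power-bracket b x 1<b (s≤s z≤n)
  ... | h , bʰ≤x , x<bʰ⁺¹ with suc x <? b ^ suc h
  ...   | yes 1+x<bʰ⁺¹ = h , m≤n⇒m≤1+n bʰ≤x , 1+x<bʰ⁺¹
  ...   | no  1+x≮bʰ⁺¹ = suc h , ≮⇒≥ 1+x≮bʰ⁺¹ ,
          ≤-<-trans x<bʰ⁺¹ (^-monoʳ-< b 1<b (n<1+n (suc h)))

  ^-cancelʳ-≤ : ∀ b m n → 1 < b → b ^ m ≤ b ^ n → m ≤ n
  ^-cancelʳ-≤ b m n 1<b bᵐ≤bⁿ with m ≤? n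
  ... | yes m≤n = m≤n
  ... | no  m≰n = contradiction bᵐ≤bⁿ (<⇒≱ (^-monoʳ-< b 1<b (≰⇒> m≰n)))

  -- Fails at h = 11, where 57 * 37 = 2109 > 2048; hence the threshold 4 ^ 12 for x.
  57[2h+15]<2^h : ∀ h → 12 ≤ h → 57 * (2 * h + 15) < 2 ^ h
  57[2h+15]<2^h h 12≤h = go (≤⇒≤′ 12≤h)
    where
    open ≤-Reasoning
    split : ∀ h → 57 * (2 * suc h + 15) ≡ 57 * (2 * h + 15) + 114
    split = solve-∀
    go : ∀ {h} → 12 ≤′ h → 57 * (2 * h + 15) < 2 ^ h
    go ≤′-refl             = ≤ᵇ⇒≤ _ _ tt
    go (≤′-step {h} 12≤′h) = begin-strict
      57 * (2 * suc h + 15)                   ≡⟨ split h ⟩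
      57 * (2 * h + 15) + 114                 ≤⟨ +-monoʳ-≤ _ (*-monoʳ-≤ 57 (≤-trans (≤ᵇ⇒≤ 2 15 tt) (m≤n+m 15 (2 * h)))) ⟩
      57 * (2 * h + 15) + 57 * (2 * h + 15)   <⟨ +-mono-< (go 12≤′h) (go 12≤′h) ⟩
      2 ^ h + 2 ^ h                           ≡⟨ cong (2 ^ h +_) (+-identityʳ (2 ^ h)) ⟨
      2 ^ suc h                               ∎

  -- Since W ≤ 2 ^ h, the right side is at most (2 h + 15) * 285 * 2 ^ h with 285 = 57 * 5, of order
  -- √x log x, while the left side is at least 5 * 4 ^ h.
  exponents-collide : ∀ h x W → 12 ≤ h → 4 ^ h ≤ x → W ≤ 2 ^ 12 →
    ¬ 5 * x ≤ (2 * h + 15) * (2 * (71 * 2 ^ suc h) + W)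
  exponents-collide h x W 12≤h 4ʰ≤x W≤ 5x≤ = <-irrefl refl (begin-strict
    5 * x
      ≤⟨ 5x≤ ⟩
    (2 * h + 15) * (2 * (71 * (2 * 2 ^ h)) + W)
      ≤⟨ *-monoʳ-≤ (2 * h + 15) (+-monoʳ-≤ _ (≤-trans W≤ (^-monoʳ-≤ 2 12≤h))) ⟩
    (2 * h + 15) * (2 * (71 * (2 * 2 ^ h)) + 2 ^ h)
      ≡⟨ collect (2 * h + 15) (2 ^ h) ⟩
    57 * (2 * h + 15) * (5 * 2 ^ h)
      <⟨ *-monoˡ-< (5 * 2 ^ h) {{m*n≢0 5 (2 ^ h) {{_}} {{m^n≢0 2 h}}}} (57[2h+15]<2^h h 12≤h) ⟩
    2 ^ h * (5 * 2 ^ h)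
      ≡⟨ square (2 ^ h) ⟩
    5 * (2 ^ h * 2 ^ h)
      ≡⟨ cong (5 *_) (^-distribʳ-* h 2 2) ⟨
    5 * 4 ^ h
      ≤⟨ *-monoʳ-≤ 5 4ʰ≤x ⟩
    5 * x ∎)
    where
    open ≤-Reasoning
    collect : ∀ a t → a * (2 * (71 * (2 * t)) + t) ≡ 57 * a * (5 * t)
    collect = solve-∀
    square : ∀ t → t * (5 * t) ≡ 5 * (t * t)
    square = solve-∀

  -- Binary logarithms are compared: at least 25 x bits of growth against 8 y bits from the tail,
  -- where y = ⌊5x/2⌋, and M (2 s + W) bits from the rest. The tail takes at most 20 x, which leaves
  -- 5 x for `exponents-collide`.
  growth-too-fast : ∀ G g W x h s → .{{_ : NonZero g}} → g * 2 ^ 25 ≤ G → W ≤ 2 ^ 12 →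
    12 ≤ h → 4 ^ h ≤ x → x < 4 ^ suc h → s ≡ 71 * 2 ^ suc h →
    ¬ G ^ x ≤ g ^ x * (((x * 5040) ^ s * 16 ^ (x * 5040 ÷ 2016)) ^ 2 * suc (x * 5040) ^ W)
  growth-too-fast G g W x h s gap W≤ 12≤h 4ʰ≤x x<4ʰ⁺¹ s≡ G≤ =
    exponents-collide h x W 12≤h 4ʰ≤x W≤ (subst (λ s → 5 * x ≤ M * (2 * s + W)) s≡ (+-cancelʳ-≤ (20 * x) _ _ (begin
      5 * x + 20 * x                                  ≡⟨ *-distribʳ-+ x 5 20 ⟨
      25 * x                                          ≤⟨ ^-cancelʳ-≤ 2 _ _ (s≤s (s≤s z≤n)) two-powers ⟩
      (M * s + 4 * y) * 2 + M * W                     ≡⟨ expand M s y W ⟩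
      M * (2 * s + W) + 8 * y                         ≤⟨ +-monoʳ-≤ (M * (2 * s + W)) 8y≤20x ⟩
      M * (2 * s + W) + 20 * x                        ∎)))
    where
    open ≤-Reasoning
    -- x < 4 ^ (h + 1) and 5040 ≤ 2 ^ 13 give N fewer than 2 (h + 1) + 13 binary digits' worth of
    -- size, that is N < 2 ^ M.
    M = 2 * h + 15
    N = x * 5040
    y = N ÷ 2016
    expand : ∀ M s y W → (M * s + 4 * y) * 2 + M * W ≡ M * (2 * s + W) + 8 * y
    expand = solve-∀
    8y≤20x : 8 * y ≤ 20 * x
    8y≤20x = *-cancelʳ-≤ (8 * y) (20 * x) 252 (begin
      8 * y * 252   ≡⟨ l y ⟩
      y * 2016      ≤⟨ m/n*n≤m N 2016 ⟩
      x * 5040      ≡⟨ r x ⟩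
      20 * x * 252  ∎)
      where
      l : ∀ y → 8 * y * 252 ≡ y * 2016
      l = solve-∀
      r : ∀ x → x * 5040 ≡ 20 * x * 252
      r = solve-∀
    N<2^M : suc N ≤ 2 ^ M
    N<2^M = begin
      suc (x * 5040)         ≤⟨ *-monoˡ-< 5040 x<4ʰ⁺¹ ⟩
      4 ^ suc h * 5040       ≤⟨ *-monoʳ-≤ (4 ^ suc h) (≤ᵇ⇒≤ 5040 (2 ^ 13) tt) ⟩
      4 ^ suc h * 2 ^ 13     ≡⟨ cong (_* 2 ^ 13) (^-*-assoc 2 2 (suc h)) ⟩
      2 ^ (2 * suc h) * 2 ^ 13 ≡⟨ ^-distribˡ-+-* 2 (2 * suc h) 13 ⟨
      2 ^ (2 * suc h + 13)   ≡⟨ cong (2 ^_) (e h) ⟩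
      2 ^ M                  ∎
      where
      e : ∀ h → 2 * suc h + 13 ≡ 2 * h + 15
      e = solve-∀
    two-powers : 2 ^ (25 * x) ≤ 2 ^ ((M * s + 4 * y) * 2 + M * W)
    two-powers = begin
      2 ^ (25 * x)
        ≡⟨ ^-*-assoc 2 25 x ⟨
      (2 ^ 25) ^ x
        ≤⟨ *-cancelˡ-≤ (g ^ x) {{m^n≢0 g x}} (begin
             g ^ x * (2 ^ 25) ^ x  ≡⟨ ^-distribʳ-* x g (2 ^ 25) ⟨
             (g * 2 ^ 25) ^ x      ≤⟨ ^-monoˡ-≤ x gap ⟩
             G ^ x                 ≤⟨ G≤ ⟩
             g ^ x * ((N ^ s * 16 ^ y) ^ 2 * suc N ^ W) ∎) ⟩
      (N ^ s * 16 ^ y) ^ 2 * suc N ^ W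
        ≤⟨ *-mono-≤ (^-monoˡ-≤ 2 (*-mono-≤ (^-monoˡ-≤ s (≤-trans (n≤1+n N) N<2^M)) (≤-reflexive (^-*-assoc 2 4 y))))
                    (^-monoˡ-≤ W N<2^M) ⟩
      ((2 ^ M) ^ s * 2 ^ (4 * y)) ^ 2 * (2 ^ M) ^ W
        ≡⟨ cong₂ (λ u v → (u * 2 ^ (4 * y)) ^ 2 * v) (^-*-assoc 2 M s) (^-*-assoc 2 M W) ⟩
      (2 ^ (M * s) * 2 ^ (4 * y)) ^ 2 * 2 ^ (M * W)
        ≡⟨ cong (λ u → u ^ 2 * 2 ^ (M * W)) (^-distribˡ-+-* 2 (M * s) (4 * y)) ⟨
      (2 ^ (M * s + 4 * y)) ^ 2 * 2 ^ (M * W)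
        ≡⟨ cong (_* 2 ^ (M * W)) (^-*-assoc 2 (M * s + 4 * y) 2) ⟩
      2 ^ ((M * s + 4 * y) * 2) * 2 ^ (M * W)
        ≡⟨ ^-distribˡ-+-* 2 ((M * s + 4 * y) * 2) (M * W) ⟨
      2 ^ ((M * s + 4 * y) * 2 + M * W) ∎

  ÷-bounds : ∀ {n d q} → n ÷ d ≡ suc q → suc q * d ≤ n × n < suc (suc q) * d
  ÷-bounds {n} {suc d} {q} eq = subst (λ y → y * suc d ≤ n) eq (m/n*n≤m n (suc d)) , (begin-strict
    n                             ≡⟨ m≡m%n+[m/n]*n n (suc d) ⟩
    n % suc d + n / suc d * suc d <⟨ +-monoˡ-< (n / suc d * suc d) (m%n<n n (suc d)) ⟩
    suc d + n / suc d * suc d     ≡⟨ cong (λ y → suc d + y * suc d) eq ⟩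
    suc (suc q) * suc d           ∎)
    where open ≤-Reasoning

  -- A bounded search for a prime p with ⌊5040 x / p⌋ = 8; its failure is the hypothesis of
  -- `prime-gap-bound`.
  prime-in-[560x,630x] : ∀ x → 4 ^ 12 ≤ x → ∃ λ p → Prime p × (8 * p ≤ x * 5040 × x * 5040 < 9 * p)
  prime-in-[560x,630x] x 4¹²≤x with anyUpTo? (λ p → prime? p ×-dec (x * 5040 ÷ p ≟ 8)) (suc (x * 5040))
  ... | yes (p , _ , pp , quot) = p , pp , ÷-bounds {d = p} quot
  ... | no none with power-bracket 4 x (s≤s (s≤s z≤n)) (≤-trans (≤ᵇ⇒≤ 1 (4 ^ 12) tt) 4¹²≤x)
  ...   | h , 4ʰ≤x , x<4ʰ⁺¹ = ⊥-elim (growth-too-fast (growth 5040 pos) (growth 5040 neg) (weight 5040 neg) x h s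
            {{growth-nonZero}} growth-gap weight-neg≤ 12≤h 4ʰ≤x x<4ʰ⁺¹ refl
            (prime-gap-bound 5040 pos-valid neg-valid refl {u = 8} {K = 2016} {m = 2} (s≤s z≤n) (s≤s (s≤s z≤n))
              (≤ᵇ⇒≤ 2016 5040 tt) pos-dominated pos-bounded x s 1≤x noPrime large))
    where
    -- 71 * 71 = 5041 is the least square above 5040, so s * s = 5041 * 4 ^ (h + 1) exceeds 5040 x
    -- while s is still of order √x.
    s = 71 * 2 ^ suc h
    1≤x : 1 ≤ x
    1≤x = ≤-trans (≤ᵇ⇒≤ 1 (4 ^ 12) tt) 4¹²≤x
    12≤h : 12 ≤ h
    12≤h = s≤s⁻¹ (≰⇒> λ 1+h≤12 → <-irrefl refl (≤-<-trans 4¹²≤x (<-≤-trans x<4ʰ⁺¹ (^-monoʳ-≤ 4 1+h≤12))))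
    noPrime : ∀ p → Prime p → ¬ x * 5040 ÷ p ≡ 8
    noPrime p pp eq = none (p , s≤s (≤-trans (m≤n*m p 8) (proj₁ (÷-bounds {d = p} eq))) , pp , eq)
    large : ∀ p → s ≤ p → x * 5040 < p * p
    large p s≤p = begin-strict
      x * 5040                         <⟨ *-monoˡ-< 5040 x<4ʰ⁺¹ ⟩
      4 ^ suc h * 5040                 ≤⟨ *-monoʳ-≤ (4 ^ suc h) (n≤1+n 5040) ⟩
      4 ^ suc h * 5041                 ≡⟨ cong (_* 5041) (^-distribʳ-* (suc h) 2 2) ⟩
      2 ^ suc h * 2 ^ suc h * 5041     ≡⟨ square (2 ^ suc h) ⟩
      s * s                            ≤⟨ *-mono-≤ s≤p s≤p ⟩
      p * p                            ∎
      where
      open ≤-Reasoning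
      square : ∀ t → t * t * 5041 ≡ 71 * t * (71 * t)
      square t = trans (*-comm (t * t) 5041) (sym ([m*n]*[o*p]≡[m*o]*[n*p] 71 t 71 t))

-- Distinct differences on a parabola mod p, and distances in the hexagonal grid

module HexagonalPlane where

  open import Defs
  open import Data.Nat as ℕ using (ℕ; zero; suc; _≤_; _<_; NonZero; _%_)
  import Data.Nat.Properties as ℕ
  open import Data.Nat.DivMod using ([m+kn]%n≡m%n; m≡m%n+[m/n]*n)
  import Data.Nat.Divisibility as ℕ
  open import Data.Nat.Primality
  import Data.Nat.Tactic.RingSolver as ℕ-Solver
  open import Data.Integer as ℤ using (ℤ; +_; -[1+_]; -_; _+_; _-_; _*_)
  import Data.Integer.Properties as ℤ
  open import Data.Integer.Divisibility.Signed using (_∣_; divides; ∣ᵤ⇒∣; ∣⇒∣ᵤ)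
  open import Data.Integer.Tactic.RingSolver using (solve-∀)
  open import Data.Product using (_×_; _,_; ∃)
  open import Data.Sum using (_⊎_; inj₁; inj₂; [_,_]′)
  open import Relation.Binary.PropositionalEquality
  open import Relation.Nullary using (¬_; contradiction)

  ∣-+ : ∀ {k a b} → k ∣ a → k ∣ b → k ∣ a + b
  ∣-+ {k} (divides q refl) (divides q′ refl) = divides (q + q′) (sym (ℤ.*-distribʳ-+ k q q′))

  ∣-neg : ∀ {k a} → k ∣ a → k ∣ - a
  ∣-neg {k} (divides q refl) = divides (- q) (ℤ.neg-distribˡ-* q k)

  ∣-*ʳ : ∀ {k a} b → k ∣ a → k ∣ a * b
  ∣-*ʳ {k} b (divides q refl) = divides (q * b) (swap q k b)
    where
    swap : ∀ q k b → q * k * b ≡ q * b * k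
    swap = solve-∀

  prime-∣-* : ∀ {p} → Prime p → ∀ a b → + p ∣ a * b → + p ∣ a ⊎ + p ∣ b
  prime-∣-* pp a b p∣ab with euclidsLemma ℤ.∣ a ∣ ℤ.∣ b ∣ pp (subst (_ ℕ.∣_) (ℤ.abs-* a b) (∣⇒∣ᵤ p∣ab))
  ... | inj₁ p∣a = inj₁ (∣ᵤ⇒∣ p∣a)
  ... | inj₂ p∣b = inj₂ (∣ᵤ⇒∣ p∣b)

  prime-∣-double : ∀ {p} → Prime p → 2 < p → ∀ a → + p ∣ a + a → + p ∣ a
  prime-∣-double pp 2<p a p∣a+a = [ (λ p∣2 → contradiction (ℕ.∣⇒≤ (∣⇒∣ᵤ p∣2)) (ℕ.<⇒≱ 2<p)) , (λ p∣a → p∣a) ]′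
    (prime-∣-* pp (+ 2) a (subst (_ ∣_) (double a) p∣a+a))
    where
    double : ∀ a → a + a ≡ + 2 * a
    double = solve-∀

  ∣-⇒% : ∀ {p} .{{_ : NonZero p}} m n → + p ∣ + m - + n → m % p ≡ n % p
  ∣-⇒% {p} m n (divides q eq) = go q (trans (split (+ m) (+ n)) (cong (_+ + n) eq))
    where
    split : ∀ a b → a ≡ a - b + b
    split = solve-∀
    go : ∀ q → + m ≡ q * + p + + n → m % p ≡ n % p
    go (+ q) m≡ = trans (cong (_% p) (ℤ.+-injective (begin
      + m                  ≡⟨ m≡ ⟩
      + q * + p + + n      ≡⟨ cong (_+ + n) (ℤ.pos-* q p) ⟨
      + (q ℕ.* p ℕ.+ n)    ≡⟨ cong +_ (ℕ.+-comm (q ℕ.* p) n) ⟩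
      + (n ℕ.+ q ℕ.* p)    ∎))) ([m+kn]%n≡m%n n q p)
      where open ≡-Reasoning
    go -[1+ q ] m≡ = sym (trans (cong (_% p) (ℤ.+-injective (begin
      + n                                      ≡⟨ move -[1+ q ] (+ p) (+ n) ⟩
      -[1+ q ] * + p + + n + (- -[1+ q ]) * + p ≡⟨ cong (_+ + suc q * + p) m≡ ⟨
      + m + + suc q * + p                      ≡⟨ cong (λ y → + m + y) (ℤ.pos-* (suc q) p) ⟨
      + (m ℕ.+ suc q ℕ.* p)                    ∎))) ([m+kn]%n≡m%n m (suc q) p))
      where
      open ≡-Reasoning
      move : ∀ q p n → n ≡ q * p + n + (- q) * p
      move = solve-∀

  %⇒∣- : ∀ {p} .{{_ : NonZero p}} m n → m % p ≡ n % p → + p ∣ + m - + n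
  %⇒∣- {p} m n m%p≡n%p = divides (+ (m ℕ./ p) - + (n ℕ./ p)) (begin
    + m - + n
      ≡⟨ cong₂ _-_ (expand m) (expand n) ⟩
    + (m % p) + + (m ℕ./ p) * + p - (+ (n % p) + + (n ℕ./ p) * + p)
      ≡⟨ cong (λ r → + r + + (m ℕ./ p) * + p - (+ (n % p) + + (n ℕ./ p) * + p)) m%p≡n%p ⟩
    + (n % p) + + (m ℕ./ p) * + p - (+ (n % p) + + (n ℕ./ p) * + p)
      ≡⟨ cancel (+ (n % p)) (+ (m ℕ./ p)) (+ (n ℕ./ p)) (+ p) ⟩
    (+ (m ℕ./ p) - + (n ℕ./ p)) * + p ∎)
    where
    open ≡-Reasoning
    expand : ∀ m → + m ≡ + (m % p) + + (m ℕ./ p) * + p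
    expand m = trans (cong +_ (m≡m%n+[m/n]*n m p)) (cong (λ y → + (m % p) + y) (ℤ.pos-* (m ℕ./ p) p))
    cancel : ∀ r a b p → r + a * p - (r + b * p) ≡ (a - b) * p
    cancel = solve-∀

  module Parabola {p : ℕ} (pp : Prime p) (2<p : 2 < p) {I : Set} (X Y : I → ℕ) where

    private
      instance
        p≢0 : NonZero p
        p≢0 = prime⇒nonZero pp

    curve : I → ℕ
    curve i = X i ℕ.* X i ℕ.+ Y i

    module _ (same-class : ∀ i j → curve i % p ≡ curve j % p)
             (separated : ∀ i j → X i % p ≡ X j % p → Y i % p ≡ Y j % p → i ≡ j) where

      private
        x y : I → ℤ
        x i = + X i
        y i = + Y i

        curve-∣ : ∀ i j → + p ∣ (x i - x j) * (x i + x j) + (y i - y j)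
        curve-∣ i j = subst (+ p ∣_) (begin
          + curve i - + curve j                        ≡⟨ cong₂ _-_ (form i) (form j) ⟩
          x i * x i + y i - (x j * x j + y j)          ≡⟨ factor (x i) (x j) (y i) (y j) ⟩
          (x i - x j) * (x i + x j) + (y i - y j)      ∎) (%⇒∣- (curve i) (curve j) (same-class i j))
          where
          open ≡-Reasoning
          form : ∀ i → + curve i ≡ x i * x i + y i
          form i = cong (_+ y i) (ℤ.pos-* (X i) (X i))
          factor : ∀ a b c d → a * a + c - (b * b + d) ≡ (a - b) * (a + b) + (c - d)
          factor = solve-∀

      -- On one parabola y ≡ t - x², so congruent abscissae force congruent ordinates, and
      -- `separated` applies.
      abscissa-determines : ∀ i j → + p ∣ x i - x j → i ≡ j
      abscissa-determines i j p∣ = separated i j (∣-⇒% (X i) (X j) p∣) (∣-⇒% (Y i) (Y j)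
        (subst (+ p ∣_) (isolate ((x i - x j) * (x i + x j)) (y i - y j)) (∣-+ (curve-∣ i j) (∣-neg (∣-*ʳ (x i + x j) p∣)))))
        where
        isolate : ∀ a b → a + b + - a ≡ b
        isolate = solve-∀

      -- Equal differences give p ∣ 2 (xᵢ - xⱼ) (xᵢ - xₖ).
      differences-distinct : ∀ i j k l → ¬ i ≡ j → x i - x j ≡ x k - x l → y i - y j ≡ y k - y l → i ≡ k × j ≡ l
      differences-distinct i j k l i≢j Δx Δy = [ (λ p∣D → contradiction (abscissa-determines i j p∣D) i≢j) , equal ]′
        (prime-∣-* pp (x i - x j) (x i - x k + (x i - x k)) product-∣)
        where
        open ≡-Reasoning
        regroup : ∀ a b c d → a - c ≡ (a - b) - (c - d) + (b - d)
        regroup = solve-∀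
        cancel : ∀ u v → u - u + v ≡ v
        cancel = solve-∀
        shift : x i - x k ≡ x j - x l
        shift = begin
          x i - x k                              ≡⟨ regroup (x i) (x j) (x k) (x l) ⟩
          (x i - x j) - (x k - x l) + (x j - x l) ≡⟨ cong (λ u → (x i - x j) - u + (x j - x l)) Δx ⟨
          (x i - x j) - (x i - x j) + (x j - x l) ≡⟨ cancel (x i - x j) (x j - x l) ⟩
          x j - x l                              ∎
        equal : + p ∣ x i - x k + (x i - x k) → i ≡ k × j ≡ l
        equal p∣2e = abscissa-determines i k p∣e , abscissa-determines j l (subst (+ p ∣_) shift p∣e)
          where
          p∣e : + p ∣ x i - x k
          p∣e = prime-∣-double pp 2<p (x i - x k) p∣2e
        collect : ∀ D E s t → D * s + E + - (D * t + E) ≡ D * (s - t)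
        collect = solve-∀
        pair : ∀ a b c d → a + b - (c + d) ≡ a - c + (b - d)
        pair = solve-∀
        product-∣ : + p ∣ (x i - x j) * (x i - x k + (x i - x k))
        product-∣ = subst (+ p ∣_) (begin
          (x i - x j) * (x i + x j) + (y i - y j) + - ((x k - x l) * (x k + x l) + (y k - y l))
            ≡⟨ cong₂ (λ u v → (x i - x j) * (x i + x j) + (y i - y j) + - (u * (x k + x l) + v)) Δx Δy ⟨
          (x i - x j) * (x i + x j) + (y i - y j) + - ((x i - x j) * (x k + x l) + (y i - y j))
            ≡⟨ collect (x i - x j) (y i - y j) (x i + x j) (x k + x l) ⟩
          (x i - x j) * (x i + x j - (x k + x l))
            ≡⟨ cong ((x i - x j) *_) (pair (x i) (x j) (x k) (x l)) ⟩
          (x i - x j) * (x i - x k + (x j - x l))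
            ≡⟨ cong (λ u → (x i - x j) * (x i - x k + u)) shift ⟨
          (x i - x j) * (x i - x k + (x i - x k)) ∎) (∣-+ (curve-∣ i j) (∣-neg (curve-∣ k l)))

  Adj-sym : ∀ {a b} → Adj a b → Adj b a
  Adj-sym (e+ i j) = subst (λ k → Adj (i + + 1 , j) (k , j)) (back i) (e- (i + + 1) j)
    where
    back : ∀ i → i + + 1 - + 1 ≡ i
    back = solve-∀
  Adj-sym (e- i j) = subst (λ k → Adj (i - + 1 , j) (k , j)) (back i) (e+ (i - + 1) j)
    where
    back : ∀ i → i - + 1 + + 1 ≡ i
    back = solve-∀
  Adj-sym (n+ i j) = subst (λ k → Adj (i , j + + 1) (i , k)) (back j) (n- i (j + + 1))
    where
    back : ∀ i → i + + 1 - + 1 ≡ i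
    back = solve-∀
  Adj-sym (n- i j) = subst (λ k → Adj (i , j - + 1) (i , k)) (back j) (n+ i (j - + 1))
    where
    back : ∀ i → i - + 1 + + 1 ≡ i
    back = solve-∀
  Adj-sym (d+ i j) = subst₂ (λ k l → Adj (i + + 1 , j + + 1) (k , l)) (back i) (back j) (d- (i + + 1) (j + + 1))
    where
    back : ∀ i → i + + 1 - + 1 ≡ i
    back = solve-∀
  Adj-sym (d- i j) = subst₂ (λ k l → Adj (i - + 1 , j - + 1) (k , l)) (back i) (back j) (d+ (i - + 1) (j - + 1))
    where
    back : ∀ i → i - + 1 + + 1 ≡ i
    back = solve-∀

  Walk-reverse : ∀ {k a b} → Walk k a b → Walk k b a
  Walk-reverse {k} w = subst (λ n → Walk n _ _) (ℕ.+-identityʳ k) (go w (here _))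
    where
    go : ∀ {k l a b c} → Walk k a b → Walk l a c → Walk (k ℕ.+ l) b c
    go (here _) v = v
    go {suc k} {l} {b = b} {c} (step e w) v = subst (λ n → Walk n b c) (ℕ.+-suc k l) (go w (step (Adj-sym e) v))

  HexDist≤-sym : ∀ {a b r} → HexDist≤ a b r → HexDist≤ b a r
  HexDist≤-sym (k , k≤r , w) = k , k≤r , Walk-reverse w

  pt : ℕ → ℕ → Point
  pt a b = + a , + b

  east : ∀ n a b → Walk n (pt a b) (pt (n ℕ.+ a) b)
  east zero    a b = here _
  east (suc n) a b = step (e+ (+ a) (+ b)) (subst₂ (λ u v → Walk n (pt u b) (pt v b)) (ℕ.+-comm 1 a) (ℕ.+-suc n a) (east n (suc a) b))

  north : ∀ n a b → Walk n (pt a b) (pt a (n ℕ.+ b))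
  north zero    a b = here _
  north (suc n) a b = step (n+ (+ a) (+ b)) (subst₂ (λ u v → Walk n (pt a u) (pt a v)) (ℕ.+-comm 1 b) (ℕ.+-suc n b) (north n a (suc b)))

  diagonal : ∀ n a b → Walk n (pt a b) (pt (n ℕ.+ a) (n ℕ.+ b))
  diagonal zero    a b = here _
  diagonal (suc n) a b = step (d+ (+ a) (+ b)) (subst₂ (λ u v → Walk n u v)
    (cong₂ pt (ℕ.+-comm 1 a) (ℕ.+-comm 1 b)) (cong₂ pt (ℕ.+-suc n a) (ℕ.+-suc n b)) (diagonal n (suc a) (suc b)))

  Walk-++ : ∀ {k l a b c} → Walk k a b → Walk l b c → Walk (k ℕ.+ l) a c
  Walk-++ (here _)   v = v
  Walk-++ (step e w) v = step e (Walk-++ w v)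

  -- For r = 2 h this is the ball of radius h about (h , h) in the hexagonal distance.
  InHexagon : ℕ → ℕ → ℕ → ℕ → Set
  InHexagon r h a b = a ≤ r × b ≤ r × a ≤ b ℕ.+ h × b ≤ a ℕ.+ h

  -- Displacements with both coordinates of the same sign cost the larger of them, at most r (`up`).
  -- With opposite signs they cost the sum of the absolute values (`across`); this is the change of
  -- a - b, which stays between -h and h, hence at most 2 h.
  hexagon-diameter : ∀ {r h} → h ℕ.+ h ≤ r → ∀ {a b a′ b′} → InHexagon r h a b → InHexagon r h a′ b′ →
                     HexDist≤ (pt a b) (pt a′ b′) r
  hexagon-diameter {r} {h} 2h≤r = any
    where
    open ℕ.≤-Reasoning
    swap : ∀ w u b → w ℕ.+ (u ℕ.+ b) ≡ u ℕ.+ w ℕ.+ b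
    swap = ℕ-Solver.solve-∀
    exchange : ∀ a b c d → a ℕ.+ b ℕ.+ (c ℕ.+ d) ≡ a ℕ.+ c ℕ.+ (b ℕ.+ d)
    exchange = ℕ-Solver.solve-∀
    up : ∀ {a b} u v → u ℕ.+ a ≤ r → v ℕ.+ b ≤ r → HexDist≤ (pt a b) (pt (u ℕ.+ a) (v ℕ.+ b)) r
    up {a} {b} u v u+a≤r v+b≤r with ℕ.≤-total u v
    ... | inj₁ u≤v with ℕ.m≤n⇒∃[o]m+o≡n u≤v
    ...   | w , refl = u ℕ.+ w , ℕ.≤-trans (ℕ.m≤m+n (u ℕ.+ w) b) v+b≤r , Walk-++ (diagonal u a b)
            (subst (λ y → Walk w (pt (u ℕ.+ a) (u ℕ.+ b)) (pt (u ℕ.+ a) y)) (swap w u b) (north w (u ℕ.+ a) (u ℕ.+ b)))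
    up {a} {b} u v u+a≤r v+b≤r | inj₂ v≤u with ℕ.m≤n⇒∃[o]m+o≡n v≤u
    ...   | w , refl = v ℕ.+ w , ℕ.≤-trans (ℕ.m≤m+n (v ℕ.+ w) a) u+a≤r , Walk-++ (diagonal v a b)
            (subst (λ y → Walk w (pt (v ℕ.+ a) (v ℕ.+ b)) (pt y (v ℕ.+ b))) (swap w v a) (east w (v ℕ.+ a) (v ℕ.+ b)))
    across : ∀ {a b} u v → u ℕ.+ a ≤ b ℕ.+ h → v ℕ.+ b ≤ a ℕ.+ h → HexDist≤ (pt a (v ℕ.+ b)) (pt (u ℕ.+ a) b) r
    across {a} {b} u v u+a≤b+h v+b≤a+h = u ℕ.+ v , ℕ.+-cancelʳ-≤ (a ℕ.+ b) (u ℕ.+ v) r (begin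
        u ℕ.+ v ℕ.+ (a ℕ.+ b)     ≡⟨ exchange u v a b ⟩
        u ℕ.+ a ℕ.+ (v ℕ.+ b)     ≤⟨ ℕ.+-mono-≤ u+a≤b+h v+b≤a+h ⟩
        b ℕ.+ h ℕ.+ (a ℕ.+ h)     ≡⟨ exchange b h a h ⟩
        b ℕ.+ a ℕ.+ (h ℕ.+ h)     ≡⟨ ℕ.+-comm (b ℕ.+ a) (h ℕ.+ h) ⟩
        h ℕ.+ h ℕ.+ (b ℕ.+ a)     ≤⟨ ℕ.+-mono-≤ 2h≤r (ℕ.≤-reflexive (ℕ.+-comm b a)) ⟩
        r ℕ.+ (a ℕ.+ b)           ∎) ,
      Walk-++ (east u a (v ℕ.+ b)) (Walk-reverse (north v (u ℕ.+ a) b))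
    below : ∀ {m n} → m ≤ n → ∃ λ k → n ≡ k ℕ.+ m
    below {m} m≤n with ℕ.m≤n⇒∃[o]m+o≡n m≤n
    ... | k , refl = k , ℕ.+-comm m k
    rightwards : ∀ {a b a′ b′} → a ≤ a′ → InHexagon r h a b → InHexagon r h a′ b′ → HexDist≤ (pt a b) (pt a′ b′) r
    rightwards {a} {b} {a′} {b′} a≤a′ (_ , _ , _ , b≤a+h) (a′≤r , b′≤r , a′≤b′+h , _) with below a≤a′ | ℕ.≤-total b b′
    ... | u , refl | inj₁ b≤b′ with below b≤b′
    ...   | v , refl = up u v a′≤r b′≤r
    rightwards {a} {b} {a′} {b′} a≤a′ (_ , _ , _ , b≤a+h) (a′≤r , b′≤r , a′≤b′+h , _) | u , refl | inj₂ b′≤b with below b′≤b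
    ...   | v , refl = across u v a′≤b′+h b≤a+h
    any : ∀ {a b a′ b′} → InHexagon r h a b → InHexagon r h a′ b′ → HexDist≤ (pt a b) (pt a′ b′) r
    any {a} {b} {a′} {b′} A A′ with ℕ.≤-total a a′
    ... | inj₁ a≤a′ = rightwards a≤a′ A A′
    ... | inj₂ a′≤a = HexDist≤-sym (rightwards a′≤a A′ A)

-- Counting the residues that fold into the hexagon, and extracting a dense parabola

module FoldedHexagons where

  open import Defs
  open import Data.Nat
  open import Data.Nat.Properties
  open import Data.Nat.DivMod using ([m+kn]%n≡m%n; m<n⇒m%n≡m; m%n<n)
  open import Data.Nat.Primality
  open import Data.Nat.Tactic.RingSolver using (solve-∀)
  open import Data.Bool using (true; false)
  open import Data.Fin using (Fin; zero; suc)
  open import Data.Integer as ℤ using ()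
  open import Data.List using (List; []; _∷_; length; filter; map; downFrom; cartesianProduct; lookup)
  open import Data.List.Properties using (filter-++; length-++)
  open import Data.List.Membership.Propositional.Properties
    using (∈-lookup; ∈-filter⁻; ∈-cartesianProduct⁻; ∈-downFrom⁻)
  open import Data.List.Relation.Unary.All as All using (All; []; _∷_)
  import Data.List.Relation.Unary.All.Properties as All
  open import Data.List.Relation.Unary.Unique.Propositional using (Unique; []; _∷_)
  import Data.List.Relation.Unary.Unique.Propositional.Properties as Unique
  open import Data.Product using (_×_; _,_; ∃; proj₁; proj₂)
  open import Data.Sum using (_⊎_; inj₁; inj₂)
  open import Function using (_∘_)
  open import Level using (Level)
  open import Relation.Binary.PropositionalEquality
  open import Relation.Nullary using (¬_; Dec; yes; no; _because_; contradiction; ¬?)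
  open import Relation.Nullary.Decidable using (_×-dec_)
  open import Relation.Unary using (Decidable)
  open HexagonalPlane

  ∑ : ℕ → (ℕ → ℕ) → ℕ
  ∑ zero    f = 0
  ∑ (suc n) f = ∑ n f + f n

  ∑-mono : ∀ n {f g : ℕ → ℕ} → (∀ i → f i ≤ g i) → ∑ n f ≤ ∑ n g
  ∑-mono zero    h = z≤n
  ∑-mono (suc n) h = +-mono-≤ (∑-mono n h) (h n)

  ∑-+ : ∀ n (f g : ℕ → ℕ) → ∑ n (λ i → f i + g i) ≡ ∑ n f + ∑ n g
  ∑-+ zero    f g = refl
  ∑-+ (suc n) f g = trans (cong (_+ (f n + g n)) (∑-+ n f g)) (exchange (∑ n f) (∑ n g) (f n) (g n))
    where
    exchange : ∀ a b c d → a + b + (c + d) ≡ a + c + (b + d)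
    exchange = solve-∀

  ∑-0 : ∀ n → ∑ n (λ _ → 0) ≡ 0
  ∑-0 zero    = refl
  ∑-0 (suc n) = trans (+-identityʳ _) (∑-0 n)

  ∑-swap : ∀ m n (f : ℕ → ℕ → ℕ) → ∑ m (λ i → ∑ n (f i)) ≡ ∑ n (λ j → ∑ m (λ i → f i j))
  ∑-swap zero    n f = sym (∑-0 n)
  ∑-swap (suc m) n f = trans (cong (_+ ∑ n (f m)) (∑-swap m n f)) (sym (∑-+ n _ (f m)))

  -- With j = n ∸ c the sum is the triangular number j (j - 1) / 2, and two such triangles fit into
  -- a square of side j.
  ∑-∸-≤ : ∀ n c → 2 * ∑ n (_∸ c) ≤ (n ∸ c) * (n ∸ c)
  ∑-∸-≤ zero    c = z≤n
  ∑-∸-≤ (suc n) c with c ≤? n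
  ... | no  c≰n = begin
    2 * (∑ n (_∸ c) + (n ∸ c))  ≡⟨ cong (λ y → 2 * (∑ n (_∸ c) + y)) n∸c≡0 ⟩
    2 * (∑ n (_∸ c) + 0)        ≡⟨ cong (2 *_) (+-identityʳ (∑ n (_∸ c))) ⟩
    2 * ∑ n (_∸ c)              ≤⟨ ∑-∸-≤ n c ⟩
    (n ∸ c) * (n ∸ c)           ≡⟨ cong (λ y → y * y) n∸c≡0 ⟩
    0                           ≤⟨ z≤n ⟩
    (suc n ∸ c) * (suc n ∸ c)   ∎
    where
    open ≤-Reasoning
    n∸c≡0 : n ∸ c ≡ 0
    n∸c≡0 = m≤n⇒m∸n≡0 (<⇒≤ (≰⇒> c≰n))
  ... | yes c≤n = begin
    2 * (∑ n (_∸ c) + j)        ≡⟨ *-distribˡ-+ 2 (∑ n (_∸ c)) j ⟩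
    2 * ∑ n (_∸ c) + 2 * j      ≤⟨ +-mono-≤ (∑-∸-≤ n c) (n≤1+n (2 * j)) ⟩
    j * j + suc (2 * j)         ≡⟨ square j ⟩
    suc j * suc j               ≡⟨ cong (λ y → y * y) (+-∸-assoc 1 c≤n) ⟨
    (suc n ∸ c) * (suc n ∸ c)   ∎
    where
    open ≤-Reasoning
    j = n ∸ c
    square : ∀ j → j * j + suc (2 * j) ≡ suc j * suc j
    square = solve-∀

  ι : ∀ {a} {A : Set a} → Dec A → ℕ
  ι (true  because _) = 1
  ι (false because _) = 0

  module _ {a : Level} {A : Set a} where

    length-filter-∷ : ∀ {P : A → Set} (P? : Decidable P) x xs →
                      length (filter P? (x ∷ xs)) ≡ ι (P? x) + length (filter P? xs)
    length-filter-∷ P? x xs with P? x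
    ... | true  because _ = refl
    ... | false because _ = refl

    length-filter-¬ : ∀ {P : A → Set} (P? : Decidable P) xs →
                      length xs ≡ length (filter P? xs) + length (filter (¬? ∘ P?) xs)
    length-filter-¬ P? [] = refl
    length-filter-¬ P? (x ∷ xs) with P? x
    ... | true  because _ = cong suc (length-filter-¬ P? xs)
    ... | false because _ = trans (cong suc (length-filter-¬ P? xs)) (sym (+-suc _ _))

    length-filter-filter : ∀ {P Q : A → Set} (P? : Decidable P) (Q? : Decidable Q) xs →
                           length (filter P? (filter Q? xs)) ≤ length (filter P? xs)
    length-filter-filter P? Q? [] = z≤n
    length-filter-filter P? Q? (x ∷ xs) with Q? x
    ... | true  because _ = ≤-trans (≤-reflexive (length-filter-∷ P? x (filter Q? xs)))
      (≤-trans (+-monoʳ-≤ (ι (P? x)) (length-filter-filter P? Q? xs)) (≤-reflexive (sym (length-filter-∷ P? x xs))))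
    ... | false because _ = ≤-trans (length-filter-filter P? Q? xs)
      (≤-trans (m≤n+m _ (ι (P? x))) (≤-reflexive (sym (length-filter-∷ P? x xs))))

    fibre : (A → ℕ) → List A → ℕ → List A
    fibre f xs t = filter (λ a → f a ≟ t) xs

    pigeonhole : ∀ (f : A → ℕ) n k xs → All (λ a → f a < n) xs →
                 (∀ t → t < n → length (fibre f xs t) ≤ k) → length xs ≤ n * k
    pigeonhole f zero    k []       _        _ = z≤n
    pigeonhole f zero    k (x ∷ xs) (() ∷ _) _
    pigeonhole f (suc n) k xs f<1+n small = begin
      length xs                                   ≡⟨ length-filter-¬ (λ a → f a ≟ n) xs ⟩
      length (fibre f xs n) + length rest         ≤⟨ +-mono-≤ (small n ≤-refl) (pigeonhole f n k rest f<n λ t t<n →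
        ≤-trans (length-filter-filter (λ a → f a ≟ t) n? xs) (small t (m<n⇒m<1+n t<n))) ⟩
      k + n * k                                   ∎
      where
      open ≤-Reasoning
      n? : Decidable (λ a → ¬ f a ≡ n)
      n? a = ¬? (f a ≟ n)
      rest = filter n? xs
      f<n : All (λ a → f a < n) rest
      f<n = All.map (λ (f≢n , f<1+n) → ≤∧≢⇒< (s≤s⁻¹ f<1+n) f≢n)
        (All.zip (All.all-filter n? xs , All.filter⁺ n? f<1+n))

    lookup-injective : ∀ {xs : List A} → Unique xs → ∀ i j → lookup xs i ≡ lookup xs j → i ≡ j
    lookup-injective (_    ∷ _)   zero    zero    _  = refl
    lookup-injective (x≢xs ∷ _)   zero    (suc j) eq = contradiction eq (All.lookup x≢xs (∈-lookup j))
    lookup-injective (x≢xs ∷ _)   (suc i) zero    eq = contradiction (sym eq) (All.lookup x≢xs (∈-lookup i))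
    lookup-injective (_    ∷ xs!) (suc i) (suc j) eq = cong suc (lookup-injective xs! i j eq)

  argmax : ∀ n (g : ℕ → ℕ) → ∃ λ t → ∀ s → s < n → g s ≤ g t
  argmax zero g = 0 , λ _ ()
  argmax (suc n) g with argmax n g
  ... | t , max with ≤-total (g n) (g t)
  ...   | inj₁ gn≤gt = t , λ s s<1+n → case-≤ s (m<1+n⇒m<n∨m≡n s<1+n)
    where
    case-≤ : ∀ s → s < n ⊎ s ≡ n → g s ≤ g t
    case-≤ s (inj₁ s<n)  = max s s<n
    case-≤ s (inj₂ refl) = gn≤gt
  ...   | inj₂ gt≤gn = n , λ s s<1+n → case-≤ s (m<1+n⇒m<n∨m≡n s<1+n)
    where
    case-≤ : ∀ s → s < n ⊎ s ≡ n → g s ≤ g n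
    case-≤ s (inj₁ s<n)  = ≤-trans (max s s<n) gt≤gn
    case-≤ s (inj₂ refl) = ≤-refl

  box : ℕ → ℕ → List (ℕ × ℕ)
  box n m = cartesianProduct (downFrom n) (downFrom m)

  module _ {P : ℕ × ℕ → Set} (P? : Decidable P) (β : ℕ → ℕ → ℕ) (cover : ∀ x y → 1 ≤ ι (P? (x , y)) + β x y) where

    row-count : ∀ x m → m ≤ length (filter P? (map (x ,_) (downFrom m))) + ∑ m (β x)
    row-count x zero    = z≤n
    row-count x (suc m) = begin
      1 + m                                       ≤⟨ +-mono-≤ (cover x m) (row-count x m) ⟩
      ι (P? (x , m)) + β x m + (length row + ∑ m (β x)) ≡⟨ cong (λ y → ι (P? (x , m)) + β x m + y) (+-comm (length row) _) ⟩
      ι (P? (x , m)) + β x m + (∑ m (β x) + length row) ≡⟨ reorder (ι (P? (x , m))) (β x m) _ _ ⟩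
      ι (P? (x , m)) + length row + (∑ m (β x) + β x m) ≡⟨ cong (_+ _) (length-filter-∷ P? (x , m) _) ⟨
      length (filter P? (map (x ,_) (downFrom (suc m)))) + ∑ (suc m) (β x) ∎
      where
      open ≤-Reasoning
      row = filter P? (map (x ,_) (downFrom m))
      reorder : ∀ a b c d → a + b + (c + d) ≡ a + d + (c + b)
      reorder = solve-∀

    box-count : ∀ n m → n * m ≤ length (filter P? (box n m)) + ∑ n (λ x → ∑ m (β x))
    box-count zero    m = z≤n
    box-count (suc n) m = begin
      m + n * m
        ≤⟨ +-mono-≤ (row-count n m) (box-count n m) ⟩
      length row + ∑ m (β n) + (length (filter P? (box n m)) + ∑ n (λ x → ∑ m (β x)))
        ≡⟨ reorder (length row) (∑ m (β n)) (length (filter P? (box n m))) (∑ n (λ x → ∑ m (β x))) ⟩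
      length row + length (filter P? (box n m)) + ∑ (suc n) (λ x → ∑ m (β x))
        ≡⟨ cong (_+ ∑ (suc n) (λ x → ∑ m (β x))) (trans (cong length (filter-++ P? (map (n ,_) (downFrom m)) (box n m))) (length-++ row)) ⟨
      length (filter P? (box (suc n) m)) + ∑ (suc n) (λ x → ∑ m (β x)) ∎
      where
      open ≤-Reasoning
      row = filter P? (map (n ,_) (downFrom m))
      reorder : ∀ a b c d → a + b + (c + d) ≡ a + c + (d + b)
      reorder = solve-∀

  module FoldedHexagon (p h d r : ℕ) (pp : Prime p) (2<p : 2 < p) (p+d≡r : p + d ≡ r)
                       (2h≤r : h + h ≤ r) (p≤2h : p ≤ h + h) where

    private
      instance
        p≢0 : NonZero p
        p≢0 = prime⇒nonZero pp

    -- Residues mod p not represented in the hexagon, up to the reflection exchanging x and y.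
    Missing : ℕ → ℕ → Set
    Missing x y = y + h < x × d < y

    missing? : ∀ x y → Dec (Missing x y)
    missing? x y = (y + h <? x) ×-dec (d <? y)

    Present : ℕ × ℕ → Set
    Present (x , y) = ¬ Missing x y × ¬ Missing y x

    present? : Decidable Present
    present? (x , y) = ¬? (missing? x y) ×-dec ¬? (missing? y x)

    -- The missing y of row x satisfy d < y < x - h. At the largest of them, y = n, the upper
    -- condition becomes a bound on n, and below it `prefix` counts by d < y alone.
    missing-row : ∀ x n → ∑ n (λ y → ι (missing? x y)) ≤ x ∸ (h + suc d)
    missing-row x zero    = z≤n
    missing-row x (suc n) with missing? x n
    ... | no _ = ≤-trans (≤-reflexive (+-identityʳ _)) (missing-row x n)
    ... | yes (n+h<x , d<n) = begin
      ∑ n (λ y → ι (missing? x y)) + 1  ≤⟨ +-monoˡ-≤ 1 (prefix n) ⟩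
      n ∸ suc d + 1                     ≡⟨ +-comm (n ∸ suc d) 1 ⟩
      1 + (n ∸ suc d)                   ≡⟨ +-∸-assoc 1 d<n ⟨
      suc n ∸ suc d                     ≤⟨ ∸-monoˡ-≤ (suc d) (m+n≤o⇒m≤o∸n (suc n) n+h<x) ⟩
      x ∸ h ∸ suc d                     ≡⟨ ∸-+-assoc x h (suc d) ⟩
      x ∸ (h + suc d)                   ∎
      where
      open ≤-Reasoning
      prefix : ∀ n → ∑ n (λ y → ι (missing? x y)) ≤ n ∸ suc d
      prefix zero    = z≤n
      prefix (suc n) with missing? x n
      ... | no _ = ≤-trans (≤-reflexive (+-identityʳ _)) (≤-trans (prefix n) (∸-monoˡ-≤ (suc d) (n≤1+n n)))
      ... | yes (_ , d<n) = begin
        ∑ n (λ y → ι (missing? x y)) + 1  ≤⟨ +-monoˡ-≤ 1 (prefix n) ⟩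
        n ∸ suc d + 1                     ≡⟨ +-comm (n ∸ suc d) 1 ⟩
        1 + (n ∸ suc d)                   ≡⟨ +-∸-assoc 1 d<n ⟨
        suc n ∸ suc d                     ∎

    residues : List (ℕ × ℕ)
    residues = filter present? (box p p)

    -- About 2 p - 3 r / 2 when h = ⌊r / 2⌋ and d = r - p. The missing residues form a triangle and
    -- its mirror image, together at most `gap * gap` points.
    gap : ℕ
    gap = p ∸ (h + suc d)

    residues-count : p * p ≤ length residues + gap * gap
    residues-count = begin
      p * p
        ≤⟨ box-count present? β cover p p ⟩
      length residues + ∑ p (λ x → ∑ p (β x))
        ≤⟨ +-monoʳ-≤ (length residues) (begin
             ∑ p (λ x → ∑ p (β x))
               ≤⟨ ∑-mono p (λ x → ≤-reflexive (∑-+ p (λ y → ι (missing? x y)) (λ y → ι (missing? y x)))) ⟩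
             ∑ p (λ x → ∑ p (λ y → ι (missing? x y)) + ∑ p (λ y → ι (missing? y x)))
               ≡⟨ ∑-+ p _ _ ⟩
             half + ∑ p (λ x → ∑ p (λ y → ι (missing? y x)))
               ≡⟨ cong (half +_) (∑-swap p p (λ y x → ι (missing? y x))) ⟨
             half + half
               ≡⟨ cong (λ z → half + z) (+-identityʳ half) ⟨
             2 * half
               ≤⟨ *-monoʳ-≤ 2 (∑-mono p λ x → missing-row x p) ⟩
             2 * ∑ p (_∸ (h + suc d))
               ≤⟨ ∑-∸-≤ p (h + suc d) ⟩
             gap * gap ∎) ⟩
      length residues + gap * gap ∎
      where
      open ≤-Reasoning
      half = ∑ p (λ x → ∑ p (λ y → ι (missing? x y)))
      β : ℕ → ℕ → ℕ
      β x y = ι (missing? x y) + ι (missing? y x)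
      cover : ∀ x y → 1 ≤ ι (present? (x , y)) + β x y
      cover x y with missing? x y | missing? y x
      ... | yes _ | yes _ = s≤s z≤n
      ... | yes _ | no  _ = s≤s z≤n
      ... | no  _ | yes _ = s≤s z≤n
      ... | no  _ | no  _ = s≤s z≤n

    -- A pair of residues outside the band |x - y| ≤ h is brought back by adding p to its smaller
    -- coordinate.
    lift : ℕ → ℕ → ℕ
    lift x y = x + ι (x + h <? y) * p

    lift-% : ∀ {x} y → x < p → lift x y % p ≡ x
    lift-% {x} y x<p = trans ([m+kn]%n≡m%n x (ι (x + h <? y)) p) (m<n⇒m%n≡m x<p)

    p≤r : p ≤ r
    p≤r = ≤-trans (m≤m+n p d) (≤-reflexive p+d≡r)

    -- Not being missing means x ≤ d, so x + p ≤ r. The shift does not overshoot the band on the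
    -- other side, because x + p ≤ x + 2 h < y + h.
    shifted : ∀ {x y} → x + h < y → y < p → ¬ Missing y x → InHexagon r h (x + p) y
    shifted {x} {y} x+h<y y<p ¬m =
      ≤-trans (≤-reflexive (+-comm x p)) (≤-trans (+-monoʳ-≤ p (≮⇒≥ λ d<x → ¬m (x+h<y , d<x))) (≤-reflexive p+d≡r)) ,
      ≤-trans (<⇒≤ y<p) p≤r ,
      ≤-trans (+-monoʳ-≤ x p≤2h) (≤-trans (≤-reflexive (sym (+-assoc x h h))) (+-monoˡ-≤ h (<⇒≤ x+h<y))) ,
      ≤-trans (<⇒≤ y<p) (≤-trans (m≤n+m p x) (m≤m+n (x + p) h))

    mirror : ∀ {a b} → InHexagon r h a b → InHexagon r h b a
    mirror (a≤r , b≤r , a≤b+h , b≤a+h) = b≤r , a≤r , b≤a+h , a≤b+h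

    lift-hexagon : ∀ {x y} → x < p → y < p → Present (x , y) → InHexagon r h (lift x y) (lift y x)
    lift-hexagon {x} {y} x<p y<p (¬m₁ , ¬m₂) with x + h <? y | y + h <? x
    ... | yes x+h<y | yes y+h<x = contradiction (<-trans (≤-<-trans (m≤m+n x h) x+h<y) (≤-<-trans (m≤m+n y h) y+h<x)) (<-irrefl refl)
    ... | no  x+h≮y | no  y+h≮x = subst₂ (InHexagon r h) (sym (+-identityʳ x)) (sym (+-identityʳ y))
          (≤-trans (<⇒≤ x<p) p≤r , ≤-trans (<⇒≤ y<p) p≤r , ≮⇒≥ y+h≮x , ≮⇒≥ x+h≮y)
    ... | yes x+h<y | no _ = subst₂ (InHexagon r h) (cong (x +_) (sym (+-identityʳ p))) (sym (+-identityʳ y))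
          (shifted x+h<y y<p ¬m₂)
    ... | no _ | yes y+h<x = subst₂ (InHexagon r h) (sym (+-identityʳ x)) (cong (y +_) (sym (+-identityʳ p)))
          (mirror (shifted y+h<x x<p ¬m₁))

    class : ℕ × ℕ → ℕ
    class (x , y) = (lift x y * lift x y + lift y x) % p

    dense-class : ∃ λ t → length residues ≤ p * length (fibre class residues t)
    dense-class with argmax p (λ t → length (fibre class residues t))
    ... | t , max = t , pigeonhole class p _ residues (All.universal (λ (x , y) → m%n<n _ p) residues) max

    module _ (t : ℕ) where

      private
        dots : List (ℕ × ℕ)
        dots = fibre class residues t

        module _ (i : Fin (length dots)) where
          x y : ℕ
          x = proj₁ (lookup dots i)
          y = proj₂ (lookup dots i)

          in-residues = ∈-filter⁻ (λ a → class a ≟ t) {xs = residues} (∈-lookup {xs = dots} i)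
          in-box = ∈-filter⁻ present? {xs = box p p} (proj₁ in-residues)

          class≡t : class (x , y) ≡ t
          class≡t = proj₂ in-residues

          present : Present (x , y)
          present = proj₂ in-box

          x<p : x < p
          x<p = ∈-downFrom⁻ (proj₁ (∈-cartesianProduct⁻ (downFrom p) (downFrom p) (proj₁ in-box)))

          y<p : y < p
          y<p = ∈-downFrom⁻ (proj₂ (∈-cartesianProduct⁻ (downFrom p) (downFrom p) (proj₁ in-box)))

          X Y : ℕ
          X = lift x y
          Y = lift y x

        dots-unique : Unique dots
        dots-unique = Unique.filter⁺ (λ a → class a ≟ t) (Unique.filter⁺ present?
          (Unique.cartesianProduct⁺ (Unique.downFrom⁺ p) (Unique.downFrom⁺ p)))

        separated : ∀ i j → X i % p ≡ X j % p → Y i % p ≡ Y j % p → i ≡ j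
        separated i j Xi≡Xj Yi≡Yj = lookup-injective dots-unique i j (cong₂ _,_
          (trans (sym (lift-% (y i) (x<p i))) (trans Xi≡Xj (lift-% (y j) (x<p j))))
          (trans (sym (lift-% (x i) (y<p i))) (trans Yi≡Yj (lift-% (x j) (y<p j)))))

        same-class : ∀ i j → Parabola.curve pp 2<p X Y i % p ≡ Parabola.curve pp 2<p X Y j % p
        same-class i j = trans (class≡t i) (sym (class≡t j))

      class-DD : DDStar (length dots) r
      class-DD = (λ i → pt (X i) (Y i)) , record
        { distinct = λ i j eq → separated i j
            (cong (λ a → ℤ.∣ proj₁ a ∣ % p) eq) (cong (λ a → ℤ.∣ proj₂ a ∣ % p) eq)
        ; close = λ i j → hexagon-diameter 2h≤r (lift-hexagon (x<p i) (y<p i) (present i)) (lift-hexagon (x<p j) (y<p j) (present j))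
        ; diffs = λ i j k l i≢j _ eq → Parabola.differences-distinct pp 2<p X Y same-class separated i j k l i≢j
            (cong proj₁ eq) (cong proj₂ eq)
        }

    folded-hexagon-DD : ∃ λ m → DDStar m r × p * p ≤ p * m + gap * gap
    folded-hexagon-DD with dense-class
    ... | t , dense = _ , class-DD t , ≤-trans residues-count (+-monoˡ-≤ (gap * gap) dense)

-- Rational estimates: 1589/2000 exceeds μ/2 and is reached by the count

module RationalEstimates where

  open import Defs
  open import Data.Nat as ℕ using (ℕ)
  open import Data.Integer as ℤ using (+_)
  import Data.Integer.Properties as ℤ
  open import Data.Product using (_,_)
  open import Data.Rational as ℚ using (ℚ; _+_; _*_; _-_; 0ℚ; 1ℚ; _≤_; _/_; toℚᵘ; nonNegative; positive)
  open import Data.Rational.Properties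
  open import Data.Rational.Solver using (module +-*-Solver)
  open import Data.Rational.Unnormalised as ℚᵘ using (ℚᵘ; mkℚᵘ; *≤*; *≡*)
  import Data.Rational.Unnormalised.Properties as ℚᵘ
  open import Data.Sum using (inj₁; inj₂)
  open import Data.Unit using (tt)
  open import Relation.Binary.PropositionalEquality

  h₀ a₀ κ q₁ q₀ : ℚ
  h₀ = + 1589 / 2000
  a₀ = + 2743 / 5000
  κ  = ℕ→ℚ 8 * (h₀ * h₀)
  q₁ = ℕ→ℚ 4 - ℕ→ℚ 2 * a₀
  q₀ = a₀ * a₀ + ℕ→ℚ 2 * a₀ * q₁

  P : ℚ → ℚ
  P a = (ℕ→ℚ 2 + ℕ→ℚ 2 * a) - a * a

  *-nonNeg : ∀ {x y} → 0ℚ ≤ x → 0ℚ ≤ y → 0ℚ ≤ x * y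
  *-nonNeg {x} {y} 0≤x 0≤y = subst (_≤ x * y) (*-zeroʳ x) (*-monoˡ-≤-nonNeg x {{nonNegative 0≤x}} 0≤y)

  +-nonNeg : ∀ {x y} → 0ℚ ≤ x → 0ℚ ≤ y → 0ℚ ≤ x + y
  +-nonNeg {x} {y} 0≤x 0≤y = subst (_≤ x + y) (+-identityˡ 0ℚ) (+-mono-≤ 0≤x 0≤y)

  square-nonNeg : ∀ x → 0ℚ ≤ x * x
  square-nonNeg x with ≤-total 0ℚ x
  ... | inj₁ 0≤x = *-nonNeg 0≤x 0≤x
  ... | inj₂ x≤0 = subst (0ℚ ≤_) (neg*neg x) (*-nonNeg 0≤-x 0≤-x)
    where
    open +-*-Solver
    neg*neg : ∀ x → (ℚ.- x) * (ℚ.- x) ≡ x * x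
    neg*neg = solve 1 (λ x → (:- x) :* (:- x) := x :* x) refl
    0≤-x : 0ℚ ≤ ℚ.- x
    0≤-x = neg-antimono-≤ x≤0

  -- a₀ approximates (√7 - 1)/3, where P a / √(1 + a) is maximal; the quotient of κ (1 + a) - (P a)² by (a - a₀)² is
  -- P a + (q₁ - 2) a + (q₀ - 2).
  quartic : ∀ κ a₀ a → let q₁ = ℕ→ℚ 4 - ℕ→ℚ 2 * a₀ ; q₀ = a₀ * a₀ + ℕ→ℚ 2 * a₀ * q₁ in
    P a * P a + ((a - a₀) * (a - a₀) * (P a + ((q₁ - ℕ→ℚ 2) * a + (q₀ - ℕ→ℚ 2))) +
      ((κ - ℕ→ℚ 8 - (a₀ * a₀ * q₁ - ℕ→ℚ 2 * a₀ * q₀)) * a + (κ - ℕ→ℚ 4 - a₀ * a₀ * q₀))) ≡ κ * (1ℚ + a)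
  quartic = solve 3 (λ κ a₀ a →
      let q₁ = c 4 :- c 2 :* a₀
          q₀ = a₀ :* a₀ :+ c 2 :* a₀ :* q₁
          P  = (c 2 :+ c 2 :* a) :- a :* a
      in P :* P :+ ((a :- a₀) :* (a :- a₀) :* (P :+ ((q₁ :- c 2) :* a :+ (q₀ :- c 2))) :+
           ((κ :- c 8 :- (a₀ :* a₀ :* q₁ :- c 2 :* a₀ :* q₀)) :* a :+ (κ :- c 4 :- a₀ :* a₀ :* q₀)))
         := κ :* (con 1ℚ :+ a)) refl
    where
    open +-*-Solver
    c : ∀ {n} → ℕ → Polynomial n
    c n = con (ℕ→ℚ n)

  -- κ = 8 h₀² lies slightly above 2 μ², the maximum of (P a)² / (1 + a). Once the multiple of (a -
  -- a₀)² is split off, this surplus makes both coefficients of the linear remainder nonnegative;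
  -- they are closed rationals, decided by evaluation.
  P²≤κ[1+a] : ∀ {a} → 0ℚ ≤ a → 0ℚ ≤ P a → P a * P a ≤ κ * (1ℚ + a)
  P²≤κ[1+a] {a} 0≤a 0≤P = subst₂ _≤_ (+-identityʳ (P a * P a)) (quartic κ a₀ a) (+-monoʳ-≤ (P a * P a)
    (+-nonNeg
      (*-nonNeg (square-nonNeg (a - a₀)) (+-nonNeg 0≤P (+-nonNeg (*-nonNeg (≤ᵇ⇒≤ {0ℚ} {q₁ - ℕ→ℚ 2} tt) 0≤a) (≤ᵇ⇒≤ {0ℚ} {q₀ - ℕ→ℚ 2} tt))))
      (+-nonNeg (*-nonNeg (≤ᵇ⇒≤ {0ℚ} {κ - ℕ→ℚ 8 - (a₀ * a₀ * q₁ - ℕ→ℚ 2 * a₀ * q₀)} tt) 0≤a)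
        (≤ᵇ⇒≤ {0ℚ} {κ - ℕ→ℚ 4 - a₀ * a₀ * q₀} tt))))

  -- Replaces the irrational bound μ/2 by a rational one just above it.
  below-half-μ⇒≤ : ∀ c → BelowHalfMu c → c ≤ h₀
  below-half-μ⇒≤ c (a , 0<a , 0<P , 0≤c , 8c²[1+a]<P²) = ≮⇒≥ λ h₀<c → <-irrefl refl (begin-strict
    P a * P a                       ≤⟨ P²≤κ[1+a] (<⇒≤ 0<a) (<⇒≤ 0<P) ⟩
    ℕ→ℚ 8 * (h₀ * h₀) * (1ℚ + a)    ≤⟨ *-monoʳ-≤-nonNeg (1ℚ + a) {{nonNegative 0≤1+a}}
                                         (*-monoˡ-≤-nonNeg (ℕ→ℚ 8) (squares (<⇒≤ h₀<c))) ⟩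
    ℕ→ℚ 8 * (c * c) * (1ℚ + a)      <⟨ 8c²[1+a]<P² ⟩
    P a * P a                       ∎)
    where
    open ≤-Reasoning
    0≤1+a : 0ℚ ≤ 1ℚ + a
    0≤1+a = +-nonNeg (≤ᵇ⇒≤ {0ℚ} {1ℚ} tt) (<⇒≤ 0<a)
    squares : h₀ ≤ c → h₀ * h₀ ≤ c * c
    squares h₀≤c = ≤-trans (*-monoˡ-≤-nonNeg h₀ h₀≤c) (*-monoʳ-≤-nonNeg c {{nonNegative 0≤c}} h₀≤c)

  ℕ→ℚᵘ : ℕ → ℚᵘ
  ℕ→ℚᵘ n = mkℚᵘ (+ n) 0

  toℚᵘ-ℕ→ℚ : ∀ n → toℚᵘ (ℕ→ℚ n) ℚᵘ.≃ ℕ→ℚᵘ n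
  toℚᵘ-ℕ→ℚ n = toℚᵘ-fromℚᵘ (ℕ→ℚᵘ n)

  ℕ→ℚ-+ : ∀ m n → ℕ→ℚ (m ℕ.+ n) ≡ ℕ→ℚ m + ℕ→ℚ n
  ℕ→ℚ-+ m n = toℚᵘ-injective (begin
    toℚᵘ (ℕ→ℚ (m ℕ.+ n))                ≈⟨ toℚᵘ-ℕ→ℚ (m ℕ.+ n) ⟩
    ℕ→ℚᵘ (m ℕ.+ n)                      ≈⟨ *≡* (cong (ℤ._* + 1) (sym (cong₂ ℤ._+_ (ℤ.*-identityʳ (+ m)) (ℤ.*-identityʳ (+ n))))) ⟩
    ℕ→ℚᵘ m ℚᵘ.+ ℕ→ℚᵘ n                  ≈⟨ ℚᵘ.+-cong (toℚᵘ-ℕ→ℚ m) (toℚᵘ-ℕ→ℚ n) ⟨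
    toℚᵘ (ℕ→ℚ m) ℚᵘ.+ toℚᵘ (ℕ→ℚ n)      ≈⟨ toℚᵘ-homo-+ (ℕ→ℚ m) (ℕ→ℚ n) ⟨
    toℚᵘ (ℕ→ℚ m + ℕ→ℚ n)                ∎)
    where open ℚᵘ.≃-Reasoning

  ℕ→ℚ-* : ∀ m n → ℕ→ℚ (m ℕ.* n) ≡ ℕ→ℚ m * ℕ→ℚ n
  ℕ→ℚ-* m n = toℚᵘ-injective (begin
    toℚᵘ (ℕ→ℚ (m ℕ.* n))                ≈⟨ toℚᵘ-ℕ→ℚ (m ℕ.* n) ⟩
    ℕ→ℚᵘ (m ℕ.* n)                      ≈⟨ *≡* (cong (ℤ._* + 1) (ℤ.pos-* m n)) ⟩
    ℕ→ℚᵘ m ℚᵘ.* ℕ→ℚᵘ n                  ≈⟨ ℚᵘ.*-cong (toℚᵘ-ℕ→ℚ m) (toℚᵘ-ℕ→ℚ n) ⟨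
    toℚᵘ (ℕ→ℚ m) ℚᵘ.* toℚᵘ (ℕ→ℚ n)      ≈⟨ toℚᵘ-homo-* (ℕ→ℚ m) (ℕ→ℚ n) ⟨
    toℚᵘ (ℕ→ℚ m * ℕ→ℚ n)                ∎)
    where open ℚᵘ.≃-Reasoning

  ℕ→ℚ-mono : ∀ {m n} → m ℕ.≤ n → ℕ→ℚ m ≤ ℕ→ℚ n
  ℕ→ℚ-mono {m} {n} m≤n = toℚᵘ-cancel-≤ (begin
    toℚᵘ (ℕ→ℚ m)  ≃⟨ toℚᵘ-ℕ→ℚ m ⟩
    ℕ→ℚᵘ m        ≤⟨ *≤* (ℤ.*-monoʳ-≤-nonNeg (+ 1) (ℤ.+≤+ m≤n)) ⟩
    ℕ→ℚᵘ n        ≃⟨ toℚᵘ-ℕ→ℚ n ⟨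
    toℚᵘ (ℕ→ℚ n)  ∎)
    where open ℚᵘ.≤-Reasoning

  0≤ℕ→ℚ : ∀ n → 0ℚ ≤ ℕ→ℚ n
  0≤ℕ→ℚ n = ℕ→ℚ-mono {0} {n} ℕ.z≤n

  0≤- : ∀ {x y} → x ≤ y → 0ℚ ≤ y - x
  0≤- {x} {y} x≤y = subst (_≤ y - x) (+-inverseʳ x) (+-monoˡ-≤ (ℚ.- x) x≤y)

  linear-slack : ∀ a b m n → m ℕ.* a ℕ.≤ n ℕ.* b → 0ℚ ≤ ℕ→ℚ b * ℕ→ℚ n - ℕ→ℚ a * ℕ→ℚ m
  linear-slack a b m n ma≤nb = 0≤- (subst₂ _≤_ (commute m a) (commute n b) (ℕ→ℚ-mono ma≤nb))
    where
    commute : ∀ m a → ℕ→ℚ (m ℕ.* a) ≡ ℕ→ℚ a * ℕ→ℚ m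
    commute m a = trans (ℕ→ℚ-* m a) (*-comm (ℕ→ℚ m) (ℕ→ℚ a))

  -- p² - (2p - 3r/2)² - h₀ p r is concave in p and positive at both ends of the range [816/1000, 45/49] of p/r.
  density-identity : ∀ p r →
    (ℕ→ℚ 2 * p - + 3 / 2 * r) * (ℕ→ℚ 2 * p - + 3 / 2 * r) + p * (h₀ * r) +
    (+ 3 / 49000 * ((ℕ→ℚ 45 * r - ℕ→ℚ 49 * p) * (ℕ→ℚ 1000 * p - ℕ→ℚ 816 * r)) +
      (+ 47 / 19600000 * (ℕ→ℚ 1000 * p - ℕ→ℚ 816 * r) + + 3 / 25000 * r) * r) ≡ p * p
  density-identity = solve 2 (λ p r →
      (con (ℕ→ℚ 2) :* p :- con (+ 3 / 2) :* r) :* (con (ℕ→ℚ 2) :* p :- con (+ 3 / 2) :* r) :+ p :* (con h₀ :* r) :+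
      (con (+ 3 / 49000) :* ((con (ℕ→ℚ 45) :* r :- con (ℕ→ℚ 49) :* p) :* (con (ℕ→ℚ 1000) :* p :- con (ℕ→ℚ 816) :* r)) :+
        (con (+ 47 / 19600000) :* (con (ℕ→ℚ 1000) :* p :- con (ℕ→ℚ 816) :* r) :+ con (+ 3 / 25000) :* r) :* r)
      := p :* p) refl
    where open +-*-Solver

  -- n stands for the side `gap`, and W = 2 p - 3 r / 2 bounds it. The chain is p h₀ r + n² ≤ p h₀ r
  -- + W² ≤ p² ≤ p m + n²; then n² and p cancel.
  density : ∀ p r m n → 0 ℕ.< p → p ℕ.* p ℕ.≤ p ℕ.* m ℕ.+ n ℕ.* n → 2 ℕ.* n ℕ.+ 3 ℕ.* r ℕ.≤ 4 ℕ.* p →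
            r ℕ.* 816 ℕ.≤ p ℕ.* 1000 → p ℕ.* 49 ℕ.≤ r ℕ.* 45 → h₀ * ℕ→ℚ r ≤ ℕ→ℚ m
  density p r m n 0<p p²≤pm+n² 2n+3r≤4p 816r≤1000p 49p≤45r =
    *-cancelˡ-≤-pos (ℕ→ℚ p) {{positive (<-≤-trans (ℚ.*<* (ℤ.+<+ ℕ.z<s)) (ℕ→ℚ-mono {1} {p} 0<p))}}
      (+-cancelʳ (ℕ→ℚ n * ℕ→ℚ n) chain)
    where
    open ≤-Reasoning
    W : ℚ
    W = ℕ→ℚ 2 * ℕ→ℚ p - + 3 / 2 * ℕ→ℚ r
    +-cancelʳ : ∀ z {x y} → x + z ≤ y + z → x ≤ y
    +-cancelʳ z {x} {y} x+z≤y+z = subst₂ _≤_ (cancel x z) (cancel y z) (+-monoˡ-≤ (ℚ.- z) x+z≤y+z)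
      where
      open +-*-Solver
      cancel : ∀ x z → x + z - z ≡ x
      cancel = solve 2 (λ x z → x :+ z :- z := x) refl
    n≤W : ℕ→ℚ n ≤ W
    n≤W = *-cancelˡ-≤-pos (ℕ→ℚ 2) (+-cancelʳ (ℕ→ℚ 3 * ℕ→ℚ r) (begin
      ℕ→ℚ 2 * ℕ→ℚ n + ℕ→ℚ 3 * ℕ→ℚ r     ≡⟨ cong₂ _+_ (ℕ→ℚ-* 2 n) (ℕ→ℚ-* 3 r) ⟨
      ℕ→ℚ (2 ℕ.* n) + ℕ→ℚ (3 ℕ.* r)     ≡⟨ ℕ→ℚ-+ (2 ℕ.* n) (3 ℕ.* r) ⟨
      ℕ→ℚ (2 ℕ.* n ℕ.+ 3 ℕ.* r)         ≤⟨ ℕ→ℚ-mono 2n+3r≤4p ⟩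
      ℕ→ℚ (4 ℕ.* p)                     ≡⟨ ℕ→ℚ-* 4 p ⟩
      ℕ→ℚ 4 * ℕ→ℚ p                     ≡⟨ split (ℕ→ℚ p) (ℕ→ℚ r) ⟩
      ℕ→ℚ 2 * W + ℕ→ℚ 3 * ℕ→ℚ r         ∎))
      where
      open +-*-Solver
      split : ∀ p r → ℕ→ℚ 4 * p ≡ ℕ→ℚ 2 * (ℕ→ℚ 2 * p - + 3 / 2 * r) + ℕ→ℚ 3 * r
      split = solve 2 (λ p r → con (ℕ→ℚ 4) :* p := con (ℕ→ℚ 2) :* (con (ℕ→ℚ 2) :* p :- con (+ 3 / 2) :* r) :+ con (ℕ→ℚ 3) :* r) refl
    n²≤W² : ℕ→ℚ n * ℕ→ℚ n ≤ W * W
    n²≤W² = ≤-trans (*-monoˡ-≤-nonNeg (ℕ→ℚ n) {{nonNegative (0≤ℕ→ℚ n)}} n≤W)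
                    (*-monoʳ-≤-nonNeg W {{nonNegative (≤-trans (0≤ℕ→ℚ n) n≤W)}} n≤W)
    q≥0 = linear-slack 49 45 p r 49p≤45r
    z≥0 = linear-slack 816 1000 r p 816r≤1000p
    -- As a function of p / r: a concave parabola vanishing at both ends of the window, plus its
    -- chord, which starts from 3/25000 at 0.816 and rises.
    remainder≥0 : 0ℚ ≤ + 3 / 49000 * ((ℕ→ℚ 45 * ℕ→ℚ r - ℕ→ℚ 49 * ℕ→ℚ p) * (ℕ→ℚ 1000 * ℕ→ℚ p - ℕ→ℚ 816 * ℕ→ℚ r)) +
      (+ 47 / 19600000 * (ℕ→ℚ 1000 * ℕ→ℚ p - ℕ→ℚ 816 * ℕ→ℚ r) + + 3 / 25000 * ℕ→ℚ r) * ℕ→ℚ r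
    remainder≥0 = +-nonNeg
      (*-nonNeg {+ 3 / 49000} (≤ᵇ⇒≤ tt) (*-nonNeg q≥0 z≥0))
      (*-nonNeg (+-nonNeg (*-nonNeg {+ 47 / 19600000} (≤ᵇ⇒≤ tt) z≥0) (*-nonNeg {+ 3 / 25000} (≤ᵇ⇒≤ tt) (0≤ℕ→ℚ r))) (0≤ℕ→ℚ r))
    chain : ℕ→ℚ p * (h₀ * ℕ→ℚ r) + ℕ→ℚ n * ℕ→ℚ n ≤ ℕ→ℚ p * ℕ→ℚ m + ℕ→ℚ n * ℕ→ℚ n
    chain = begin
      ℕ→ℚ p * (h₀ * ℕ→ℚ r) + ℕ→ℚ n * ℕ→ℚ n   ≤⟨ +-monoʳ-≤ (ℕ→ℚ p * (h₀ * ℕ→ℚ r)) n²≤W² ⟩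
      ℕ→ℚ p * (h₀ * ℕ→ℚ r) + W * W           ≡⟨ +-comm (ℕ→ℚ p * (h₀ * ℕ→ℚ r)) (W * W) ⟩
      W * W + ℕ→ℚ p * (h₀ * ℕ→ℚ r)           ≡⟨ +-identityʳ _ ⟨
      W * W + ℕ→ℚ p * (h₀ * ℕ→ℚ r) + 0ℚ      ≤⟨ +-monoʳ-≤ (W * W + ℕ→ℚ p * (h₀ * ℕ→ℚ r)) remainder≥0 ⟩
      W * W + ℕ→ℚ p * (h₀ * ℕ→ℚ r) + _       ≡⟨ density-identity (ℕ→ℚ p) (ℕ→ℚ r) ⟩
      ℕ→ℚ p * ℕ→ℚ p                          ≡⟨ ℕ→ℚ-* p p ⟨
      ℕ→ℚ (p ℕ.* p)                          ≤⟨ ℕ→ℚ-mono p²≤pm+n² ⟩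
      ℕ→ℚ (p ℕ.* m ℕ.+ n ℕ.* n)              ≡⟨ ℕ→ℚ-+ (p ℕ.* m) (n ℕ.* n) ⟩
      ℕ→ℚ (p ℕ.* m) + ℕ→ℚ (n ℕ.* n)          ≡⟨ cong₂ _+_ (ℕ→ℚ-* p m) (ℕ→ℚ-* n n) ⟩
      ℕ→ℚ p * ℕ→ℚ m + ℕ→ℚ n * ℕ→ℚ n          ∎

-- Matching the prime interval to the window for p / r

open import Defs
open import Data.Nat
open import Data.Nat.Properties
open import Data.Nat.DivMod using (m/n*n≤m; /-monoˡ-≤; m*n/n≡m; m≡m%n+[m/n]*n; m%n<n)
open import Data.Nat.Primality using (Prime)
open import Data.Nat.Tactic.RingSolver using (solve-∀)
open import Data.Product using (_×_; _,_; Σ; ∃)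
open import Data.Rational as ℚ using (ℚ)
import Data.Rational.Properties as ℚ
open import Data.Sum using (inj₁; inj₂)
open import Data.Unit using (tt)
open import Relation.Binary.PropositionalEquality
open Chebyshev using (⌈n/2⌉≤1+⌊n/2⌋)
open PrimesInIntervals using (prime-in-[560x,630x])
open FoldedHexagons using (module FoldedHexagon)
open RationalEstimates using (h₀; 0≤ℕ→ℚ; density; below-half-μ⇒≤)

-- Literals are kept as right factors, where multiplication by them does not unfold.
*-swap : ∀ m a b → m * a * b ≡ m * b * a
*-swap = solve-∀

-- The modulus 686 is chosen so that 630 / 686 = 45 / 49: for x = ⌊r / 686⌋ the upper end of the
-- prime interval fits the window exactly.
p*49≤r*45 : ∀ r x p → x * 686 ≤ r → p * 8 ≤ x * 5040 → p * 49 ≤ r * 45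
p*49≤r*45 r x p x*686≤r p*8≤ = *-cancelʳ-≤ (p * 49) (r * 45) 8 (begin
  p * 49 * 8        ≡⟨ *-swap p 49 8 ⟩
  p * 8 * 49        ≤⟨ *-monoˡ-≤ 49 p*8≤ ⟩
  x * 5040 * 49     ≡⟨ *-assoc x 5040 49 ⟩
  x * 246960        ≡⟨ *-assoc x 686 360 ⟨
  x * 686 * 360     ≤⟨ *-monoˡ-≤ 360 x*686≤r ⟩
  r * 360           ≡⟨ *-assoc r 45 8 ⟨
  r * 45 * 8        ∎)
  where open ≤-Reasoning

-- 560 / 686 is slightly more than 0.816. The difference absorbs the rounding in x as soon as 816 *
-- 686 * (x + 1) ≤ 560000 * x, that is from x = 2499 on.
r*816≤p*1000 : ∀ r x p → r ≤ x * 686 + 686 → 2499 ≤ x → x * 5040 ≤ p * 9 → r * 816 ≤ p * 1000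
r*816≤p*1000 r x p r≤ 2499≤x ≤p*9 = *-cancelʳ-≤ (r * 816) (p * 1000) 9 (begin
  r * 816 * 9                   ≡⟨ *-assoc r 816 9 ⟩
  r * 7344                      ≤⟨ *-monoˡ-≤ 7344 r≤ ⟩
  (x * 686 + 686) * 7344        ≡⟨ *-distribʳ-+ 7344 (x * 686) 686 ⟩
  x * 686 * 7344 + 2499 * 2016  ≤⟨ +-mono-≤ (≤-reflexive (*-assoc x 686 7344)) (*-monoˡ-≤ 2016 2499≤x) ⟩
  x * 5037984 + x * 2016        ≡⟨ *-distribˡ-+ x 5037984 2016 ⟨
  x * 5040000                   ≡⟨ *-assoc x 5040 1000 ⟨
  x * 5040 * 1000               ≤⟨ *-monoˡ-≤ 1000 ≤p*9 ⟩
  p * 9 * 1000                  ≡⟨ *-swap p 9 1000 ⟩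
  p * 1000 * 9                  ∎)
  where open ≤-Reasoning

2<p-from : ∀ x p → 1 ≤ x → x * 5040 < p * 9 → 2 < p
2<p-from x p 1≤x <p*9 = ≰⇒> λ p≤2 → <⇒≱ <p*9
  (≤-trans (*-monoˡ-≤ 9 p≤2) (≤-trans (≤ᵇ⇒≤ 18 5040 tt) (m≤n*m 5040 x {{>-nonZero 1≤x}})))

prime-in-[0·816r,45/49r] : ∀ r → 4 ^ 12 * 686 ≤ r → ∃ λ p → Prime p × 2 < p × p * 49 ≤ r * 45 × r * 816 ≤ p * 1000
prime-in-[0·816r,45/49r] r large =
  let p , pp , 8p≤5040x , 5040x<9p = prime-in-[560x,630x] x 4¹²≤x
      <p*9 = subst (x * 5040 <_) (*-comm 9 p) 5040x<9p
  in p , pp , 2<p-from x p (≤-trans (≤ᵇ⇒≤ 1 (4 ^ 12) tt) 4¹²≤x) <p*9 ,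
     p*49≤r*45 r x p (m/n*n≤m r 686) (subst (_≤ x * 5040) (*-comm 8 p) 8p≤5040x) ,
     r*816≤p*1000 r x p r≤ (≤-trans (≤ᵇ⇒≤ 2499 (4 ^ 12) tt) 4¹²≤x) (<⇒≤ <p*9)
  where
  x = r / 686
  4¹²≤x : 4 ^ 12 ≤ x
  4¹²≤x = ≤-trans (≤-reflexive (sym (m*n/n≡m (4 ^ 12) 686))) (/-monoˡ-≤ 686 large)
  r≤ : r ≤ x * 686 + 686
  r≤ = ≤-trans (≤-reflexive (trans (m≡m%n+[m/n]*n r 686) (+-comm (r % 686) (x * 686))))
    (+-monoʳ-≤ (x * 686) (<⇒≤ (m%n<n r 686)))

-- If the truncated difference is 0, only 3 r ≤ 4 p is left, and 3/4 < 0.816. Otherwise the 1 in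
-- `suc d`, doubled, absorbs the rounding of h = ⌊r / 2⌋.
gap-bound : ∀ p h d r → p + d ≡ r → r ≤ suc (h + h) → r * 816 ≤ p * 1000 →
            2 * (p ∸ (h + suc d)) + 3 * r ≤ 4 * p
gap-bound p h d r p+d≡r r≤1+2h 816r≤1000p with ≤-total p (h + suc d)
... | inj₁ p≤ = subst (λ g → 2 * g + 3 * r ≤ 4 * p) (sym (m≤n⇒m∸n≡0 p≤)) (*-cancelʳ-≤ (3 * r) (4 * p) 272 (begin
  3 * r * 272     ≡⟨ trans (cong (_* 272) (*-comm 3 r)) (*-assoc r 3 272) ⟩
  r * 816         ≤⟨ 816r≤1000p ⟩
  p * 1000        ≡⟨ trans (cong (_* 250) (*-comm 4 p)) (*-assoc p 4 250) ⟨
  4 * p * 250     ≤⟨ *-monoʳ-≤ (4 * p) (≤ᵇ⇒≤ 250 272 tt) ⟩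
  4 * p * 272     ∎))
  where open ≤-Reasoning
... | inj₂ p≥ = begin
  2 * g + 3 * r                          ≡⟨ cong (λ z → 2 * g + (r + 2 * z)) p+d≡r ⟨
  2 * g + (r + 2 * (p + d))              ≤⟨ +-monoʳ-≤ (2 * g) (+-monoˡ-≤ (2 * (p + d)) (≤-trans r≤1+2h (n≤1+n _))) ⟩
  2 * g + (2 + (h + h) + 2 * (p + d))    ≡⟨ regroup g h d p ⟩
  2 * (g + (h + suc d)) + 2 * p          ≡⟨ cong (λ z → 2 * z + 2 * p) (m∸n+n≡m p≥) ⟩
  2 * p + 2 * p                          ≡⟨ *-distribʳ-+ p 2 2 ⟨
  4 * p                                  ∎
  where
  open ≤-Reasoning
  g = p ∸ (h + suc d)
  regroup : ∀ g h d p → 2 * g + (2 + (h + h) + 2 * (p + d)) ≡ 2 * (g + (h + suc d)) + 2 * p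
  regroup = solve-∀

dense-DD : ∀ r → 4 ^ 12 * 686 ≤ r → ∃ λ m → DDStar m r × h₀ ℚ.* ℕ→ℚ r ℚ.≤ ℕ→ℚ m
dense-DD r large =
  let p , pp , 2<p , 49p≤45r , 816r≤1000p = prime-in-[0·816r,45/49r] r large
      p<r = below p 49p≤45r
      -- The last argument is p ≤ 2 h, from p < r ≤ 2 h + 1; it keeps lifted points inside the band.
      m , dd , p²≤ = FoldedHexagon.folded-hexagon-DD p h (r ∸ p) r pp 2<p (m+[n∸m]≡n (<⇒≤ p<r)) 2h≤r (s≤s⁻¹ (≤-trans p<r r≤1+2h))
  in m , dd , density p r m (p ∸ (h + suc (r ∸ p))) (<-trans (s≤s z≤n) 2<p) p²≤
       (gap-bound p h (r ∸ p) r (m+[n∸m]≡n (<⇒≤ p<r)) r≤1+2h 816r≤1000p) 816r≤1000p 49p≤45r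
  where
  open ≤-Reasoning
  h = ⌊ r /2⌋
  2h≤r : h + h ≤ r
  2h≤r = ≤-trans (+-monoʳ-≤ h (⌊n/2⌋≤⌈n/2⌉ r)) (≤-reflexive (⌊n/2⌋+⌈n/2⌉≡n r))
  r≤1+2h : r ≤ suc (h + h)
  r≤1+2h = begin
    r                  ≡⟨ ⌊n/2⌋+⌈n/2⌉≡n r ⟨
    h + ⌈ r /2⌉        ≤⟨ +-monoʳ-≤ h (⌈n/2⌉≤1+⌊n/2⌋ r) ⟩
    h + suc h          ≡⟨ +-suc h h ⟩
    suc (h + h)        ∎
  below : ∀ p → p * 49 ≤ r * 45 → p < r
  below p 49p≤45r = *-cancelʳ-< 49 p r (≤-<-trans 49p≤45r
    (*-monoʳ-< r {{>-nonZero (≤-trans (≤ᵇ⇒≤ 1 (4 ^ 12 * 686) tt) large)}} (≤ᵇ⇒≤ 46 49 tt)))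

theorem20 : (c : ℚ) → BelowHalfMu c →
    Σ ℕ λ R → (r : ℕ) → 1 ≤ r → R ≤ r →
    Σ ℕ λ m → DDStar m r × (c ℚ.* ℕ→ℚ r ℚ.≤ ℕ→ℚ m)
-- The threshold does not depend on c, because every admissible c is at most 1589/2000.
theorem20 c c<μ/2 = 4 ^ 12 * 686 , λ r _ R≤r →
  let m , dd , h₀r≤m = dense-DD r R≤r
  in m , dd , ℚ.≤-trans (ℚ.*-monoʳ-≤-nonNeg (ℕ→ℚ r) {{ℚ.nonNegative (0≤ℕ→ℚ r)}} (below-half-μ⇒≤ c c<μ/2)) h₀r≤m
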